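{- Let $F$ be any subfield of $\mathbb{R}$, let $f(x_1,\ldots,x_k)$ be a multivariate polynomial with coefficients in $F$, and let $I=[0,1]^k$. Then $f$ is nonzero at every point of $I$ if and only if $T[F]$ proves the sentence $\forall x_1\cdots\forall x_k\,\bigl(\bigwedge_{i=1}^k(0\le x_i\wedge x_i\le1)\rightarrow f(x_1,\ldots,x_k)\ne0\bigr)$, where $f$ is written as a term in the language of $T[F]$ (a sum of monomials $f_c(x_1^{e_1}\times\cdots\times x_k^{e_k})$).
   Context: For $a\in F$, $f_a$ is a unary function symbol interpreted as $f_a(x)=ax$. $T_{\mathrm{add}}[F]$ is the set of sentences true in $(\mathbb{R},0,1,+,-,<,(f_a)_{a\in F})$, $T_{\mathrm{mult}}[F]$ the set of sentences true in $(\mathbb{R},0,1,\times,\div,<,(f_a)_{a\in F})$ with $x\div0=0$, and $T[F]=T_{\mathrm{add}}[F]\cup T_{\mathrm{mult}}[F]$, a theory in the union of the two languages. -}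

module Defs where

open import Algebra.Bundles using (CommutativeRing; RawSemiring)
import Algebra.Definitions.RawSemiring as RawSemiringDefinitions
open import Data.Empty.Polymorphic using (⊥)
open import Data.Fin.Base using (Fin; zero; suc; opposite)
open import Data.List.Base as List using (List; []; _∷_)
open import Data.List.Membership.Propositional using (_∈_)
open import Data.Nat.Base using (ℕ; zero; suc)
open import Data.Product.Base using (Σ; ∃; ∃-syntax; _×_; _,_; proj₁)
open import Data.Sum.Base using (_⊎_)
open import Data.Vec.Base as Vec using (Vec; []; _∷_)
open import Data.Vec.Functional as Vector using (Vector)
open import Level using (Level) renaming (suc to lsuc)
open import Relation.Binary.Core using (Rel)
import Relation.Binary.Construct.StrictToNonStrict as StrictToNonStrict
open import Relation.Binary.Definitions using (_Respects_)
open import Relation.Binary.PropositionalEquality.Core using (_≡_)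
open import Relation.Binary.Structures using (IsStrictTotalOrder)
open import Relation.Nullary using (¬_; yes; no)
open import Relation.Unary using (Pred; _∪_)

------------------------------------------------------------------------
-- The real numbers.
--
-- The library has no real numbers, so ℝ is taken to be an arbitrary
-- Dedekind-complete ordered field; in the presence of excluded middle
-- these axioms determine it up to isomorphism.

record CompleteOrderedField (ℓ : Level) : Set (lsuc ℓ) where
  infix 4 _<_
  infixl 7 _÷_
  field
    commutativeRing    : CommutativeRing ℓ ℓ
  open CommutativeRing commutativeRing public
  field
    _<_                : Rel Carrier ℓ
    isStrictTotalOrder : IsStrictTotalOrder _≈_ _<_
    0≉1                : ¬ 0# ≈ 1#
    inverse            : ∀ x → ¬ x ≈ 0# → ∃[ y ] x * y ≈ 1#
    +-monoˡ-<          : ∀ z {x y} → x < y → x + z < y + z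
    *-positive         : ∀ {x y} → 0# < x → 0# < y → 0# < x * y

  open IsStrictTotalOrder isStrictTotalOrder public using (_≟_; compare)
  open StrictToNonStrict _≈_ _<_ public using (_≤_)

  UpperBound : Pred Carrier ℓ → Pred Carrier ℓ
  UpperBound P b = ∀ x → P x → x ≤ b

  field
    complete : (P : Pred Carrier ℓ) → ∃ P → ∃ (UpperBound P) →
               ∃[ s ] UpperBound P s × (∀ b → UpperBound P b → s ≤ b)

  _÷_ : Carrier → Carrier → Carrier
  x ÷ y with y ≟ 0#
  ... | yes _  = 0#
  ... | no y≉0 = x * proj₁ (inverse y y≉0)

  rawSemiring : RawSemiring ℓ ℓ
  rawSemiring = record
    { Carrier = Carrier ; _≈_ = _≈_ ; _+_ = _+_ ; _*_ = _*_ ; 0# = 0# ; 1# = 1# }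

module _ {ℓ} (ℝ : CompleteOrderedField ℓ) where
  open CompleteOrderedField ℝ

  record IsSubfield (F : Pred Carrier ℓ) : Set ℓ where
    field
      respects  : F Respects _≈_
      0-closed  : F 0#
      1-closed  : F 1#
      +-closed  : ∀ {x y} → F x → F y → F (x + y)
      *-closed  : ∀ {x y} → F x → F y → F (x * y)
      -‿closed  : ∀ {x} → F x → F (- x)
      ⁻¹-closed : ∀ {x y} → F x → x * y ≈ 1# → F y

------------------------------------------------------------------------
-- First-order logic with equality.
--
-- Terms and formulas are well scoped: `Formula L n` has its free
-- variables among `Fin n`, and index zero is bound by the innermost
-- quantifier.

record Language (ℓ : Level) : Set (lsuc ℓ) where
  field
    Function : ℕ → Set ℓ
    Relation : ℕ → Set

module Syntax {ℓ} (L : Language ℓ) where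
  open Language L

  infix  8 _≐_
  infixr 7 _∧_
  infixr 6 _∨_
  infixr 5 _⇒_

  data Term (n : ℕ) : Set ℓ where
    var : Fin n → Term n
    fun : ∀ {m} → Function m → Vec (Term n) m → Term n

  data Formula (n : ℕ) : Set ℓ where
    _≐_         : Term n → Term n → Formula n
    rel         : ∀ {m} → Relation m → Vec (Term n) m → Formula n
    ⊥′          : Formula n
    _∧_ _∨_ _⇒_ : Formula n → Formula n → Formula n
    ∀′ ∃′       : Formula (suc n) → Formula n

  Sentence : Set ℓ
  Sentence = Formula 0

  Theory : Set (lsuc ℓ)
  Theory = Pred Sentence ℓ

  infix 9 ¬′_
  ¬′_ : ∀ {n} → Formula n → Formula n
  ¬′ φ = φ ⇒ ⊥′

  ⋀ : ∀ {n k} → Vector (Formula n) k → Formula n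
  ⋀ = Vector.foldr _∧_ (¬′ ⊥′)

  ∀* : ∀ {n} → Formula n → Sentence
  ∀* {zero}  φ = φ
  ∀* {suc n} φ = ∀* (∀′ φ)

  Substitution : ℕ → ℕ → Set ℓ
  Substitution m n = Fin m → Term n

  mutual
    substTerm : ∀ {m n} → Substitution m n → Term m → Term n
    substTerm σ (var i)    = σ i
    substTerm σ (fun f ts) = fun f (substTerms σ ts)

    substTerms : ∀ {m n k} → Substitution m n → Vec (Term m) k → Vec (Term n) k
    substTerms σ []       = []
    substTerms σ (t ∷ ts) = substTerm σ t ∷ substTerms σ ts

  shift : ∀ {n} → Substitution n (suc n)
  shift i = var (suc i)

  lift : ∀ {m n} → Substitution m n → Substitution (suc m) (suc n)
  lift σ zero    = var zero
  lift σ (suc i) = substTerm shift (σ i)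

  subst : ∀ {m n} → Substitution m n → Formula m → Formula n
  subst σ (s ≐ t)    = substTerm σ s ≐ substTerm σ t
  subst σ (rel R ts) = rel R (substTerms σ ts)
  subst σ ⊥′         = ⊥′
  subst σ (φ ∧ ψ)    = subst σ φ ∧ subst σ ψ
  subst σ (φ ∨ ψ)    = subst σ φ ∨ subst σ ψ
  subst σ (φ ⇒ ψ)    = subst σ φ ⇒ subst σ ψ
  subst σ (∀′ φ)     = ∀′ (subst (lift σ) φ)
  subst σ (∃′ φ)     = ∃′ (subst (lift σ) φ)

  weaken : ∀ {n} → Formula n → Formula (suc n)
  weaken = subst shift

  single : ∀ {n} → Term n → Substitution (suc n) n
  single t zero    = t
  single t (suc i) = var i

  infix 9 _[_]
  _[_] : ∀ {n} → Formula (suc n) → Term n → Formula n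
  φ [ t ] = subst (single t) φ

  -- Classical natural deduction. The index n lists the variables that
  -- may occur free, so the eigenvariable conditions of ∀-intro and
  -- ∃-elim are enforced by weakening the context.

  infix 3 _∣_⊢_ _⊢_

  data _∣_⊢_ (T : Theory) {n : ℕ} (Γ : List (Formula n)) : Formula n → Set ℓ where
    axiom   : ∀ {φ} → T φ → T ∣ Γ ⊢ subst (λ ()) φ
    assume  : ∀ {φ} → φ ∈ Γ → T ∣ Γ ⊢ φ
    raa     : ∀ {φ} → T ∣ ¬′ φ ∷ Γ ⊢ ⊥′ → T ∣ Γ ⊢ φ
    ∧-intro : ∀ {φ ψ} → T ∣ Γ ⊢ φ → T ∣ Γ ⊢ ψ → T ∣ Γ ⊢ φ ∧ ψ
    ∧-elim₁ : ∀ {φ ψ} → T ∣ Γ ⊢ φ ∧ ψ → T ∣ Γ ⊢ φ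
    ∧-elim₂ : ∀ {φ ψ} → T ∣ Γ ⊢ φ ∧ ψ → T ∣ Γ ⊢ ψ
    ∨-intro₁ : ∀ {φ ψ} → T ∣ Γ ⊢ φ → T ∣ Γ ⊢ φ ∨ ψ
    ∨-intro₂ : ∀ {φ ψ} → T ∣ Γ ⊢ ψ → T ∣ Γ ⊢ φ ∨ ψ
    ∨-elim  : ∀ {φ ψ χ} → T ∣ Γ ⊢ φ ∨ ψ →
              T ∣ φ ∷ Γ ⊢ χ → T ∣ ψ ∷ Γ ⊢ χ → T ∣ Γ ⊢ χ
    ⇒-intro : ∀ {φ ψ} → T ∣ φ ∷ Γ ⊢ ψ → T ∣ Γ ⊢ φ ⇒ ψ
    ⇒-elim  : ∀ {φ ψ} → T ∣ Γ ⊢ φ ⇒ ψ → T ∣ Γ ⊢ φ → T ∣ Γ ⊢ ψ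
    ∀-intro : ∀ {φ} → T ∣ List.map weaken Γ ⊢ φ → T ∣ Γ ⊢ ∀′ φ
    ∀-elim  : ∀ {φ} → T ∣ Γ ⊢ ∀′ φ → ∀ t → T ∣ Γ ⊢ φ [ t ]
    ∃-intro : ∀ {φ} t → T ∣ Γ ⊢ φ [ t ] → T ∣ Γ ⊢ ∃′ φ
    ∃-elim  : ∀ {φ χ} → T ∣ Γ ⊢ ∃′ φ →
              T ∣ φ ∷ List.map weaken Γ ⊢ weaken χ → T ∣ Γ ⊢ χ
    ≐-refl  : ∀ t → T ∣ Γ ⊢ t ≐ t
    ≐-subst : ∀ φ {s t} → T ∣ Γ ⊢ s ≐ t → T ∣ Γ ⊢ φ [ s ] → T ∣ Γ ⊢ φ [ t ]

  _⊢_ : Theory → Sentence → Set ℓ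
  T ⊢ φ = T ∣ [] ⊢ φ

record Structure {ℓ} (L : Language ℓ) : Set (lsuc ℓ) where
  open Language L
  field
    Carrier  : Set ℓ
    equality : Rel Carrier ℓ
    function : ∀ {m} → Function m → Vec Carrier m → Carrier
    relation : ∀ {m} → Relation m → Vec Carrier m → Set ℓ

module Semantics {ℓ} {L : Language ℓ} (S : Structure L) where
  open Syntax L
  open Structure S

  mutual
    valueTerm : ∀ {n} → Vec Carrier n → Term n → Carrier
    valueTerm ρ (var i)    = Vec.lookup ρ i
    valueTerm ρ (fun f ts) = function f (valueTerms ρ ts)

    valueTerms : ∀ {n k} → Vec Carrier n → Vec (Term n) k → Vec Carrier k
    valueTerms ρ []       = []
    valueTerms ρ (t ∷ ts) = valueTerm ρ t ∷ valueTerms ρ ts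

  Holds : ∀ {n} → Vec Carrier n → Formula n → Set ℓ
  Holds ρ (s ≐ t)    = equality (valueTerm ρ s) (valueTerm ρ t)
  Holds ρ (rel R ts) = relation R (valueTerms ρ ts)
  Holds ρ ⊥′         = ⊥
  Holds ρ (φ ∧ ψ)    = Holds ρ φ × Holds ρ ψ
  Holds ρ (φ ∨ ψ)    = Holds ρ φ ⊎ Holds ρ ψ
  Holds ρ (φ ⇒ ψ)    = Holds ρ φ → Holds ρ ψ
  Holds ρ (∀′ φ)     = ∀ x → Holds (x ∷ ρ) φ
  Holds ρ (∃′ φ)     = ∃[ x ] Holds (x ∷ ρ) φ

  Th : Theory
  Th φ = Holds [] φ

record Inclusion {ℓ} (L M : Language ℓ) : Set ℓ where
  private
    module L = Language L
    module M = Language M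
  field
    onFunction : ∀ {m} → L.Function m → M.Function m
    onRelation : ∀ {m} → L.Relation m → M.Relation m

module Translation {ℓ} {L M : Language ℓ} (ι : Inclusion L M) where
  open Inclusion ι
  private
    module L = Syntax L
    module M = Syntax M
  open L using (var; fun; _≐_; rel; ⊥′; _∧_; _∨_; _⇒_; ∀′; ∃′)

  mutual
    translateTerm : ∀ {n} → L.Term n → M.Term n
    translateTerm (var i)    = M.var i
    translateTerm (fun f ts) = M.fun (onFunction f) (translateTerms ts)

    translateTerms : ∀ {n k} → Vec (L.Term n) k → Vec (M.Term n) k
    translateTerms []       = []
    translateTerms (t ∷ ts) = translateTerm t ∷ translateTerms ts

  translate : ∀ {n} → L.Formula n → M.Formula n
  translate (s ≐ t)    = translateTerm s M.≐ translateTerm t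
  translate (rel R ts) = M.rel (onRelation R) (translateTerms ts)
  translate ⊥′         = M.⊥′
  translate (φ ∧ ψ)    = translate φ M.∧ translate ψ
  translate (φ ∨ ψ)    = translate φ M.∨ translate ψ
  translate (φ ⇒ ψ)    = translate φ M.⇒ translate ψ
  translate (∀′ φ)     = M.∀′ (translate φ)
  translate (∃′ φ)     = M.∃′ (translate φ)

  image : L.Theory → M.Theory
  image T φ = ∃[ ψ ] T ψ × φ ≡ translate ψ

------------------------------------------------------------------------
-- Polynomials: formal sums of monomials a x₁^e₁ ⋯ x_k^e_k, not
-- necessarily with distinct exponent vectors.
--
-- `evaluate` is used twice below: in ℝ, where a · x is multiplication, to
-- get the values of a polynomial, and in the algebra of terms, where a · t
-- is f_a(t), to get the term it denotes. Sums, products and powers are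
-- right-nested and end in 0, 1 and 1 respectively.

Polynomial : ∀ {ℓ} → Set ℓ → ℕ → Set ℓ
Polynomial A k = List (A × Vector ℕ k)

module Evaluation {c ℓ a} (S : RawSemiring c ℓ) {A : Set a}
                  (_·_ : A → RawSemiring.Carrier S → RawSemiring.Carrier S) where
  open RawSemiring S using (Carrier; _+_; 0#)
  open RawSemiringDefinitions S using (_^_; product)

  evaluate : ∀ {k} → Polynomial A k → Vector Carrier k → Carrier
  evaluate p x =
    List.foldr (λ (a , e) s → (a · product (λ i → x i ^ e i)) + s) 0# p

------------------------------------------------------------------------
-- The languages and theories. Both minus and division are binary.

data AddFunction {ℓ} (A : Set ℓ) : ℕ → Set ℓ where
  𝟘 𝟙        : AddFunction A 0
  plus minus : AddFunction A 2
  scale      : A → AddFunction A 1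

data MultFunction {ℓ} (A : Set ℓ) : ℕ → Set ℓ where
  𝟘 𝟙          : MultFunction A 0
  times divide : MultFunction A 2
  scale        : A → MultFunction A 1

data FieldFunction {ℓ} (A : Set ℓ) : ℕ → Set ℓ where
  𝟘 𝟙                     : FieldFunction A 0
  plus minus times divide : FieldFunction A 2
  scale                   : A → FieldFunction A 1

data OrderRelation : ℕ → Set where
  less : OrderRelation 2

module _ {ℓ} (A : Set ℓ) where

  L-add L-mult L-field : Language ℓ
  L-add   = record { Function = AddFunction A   ; Relation = OrderRelation }
  L-mult  = record { Function = MultFunction A  ; Relation = OrderRelation }
  L-field = record { Function = FieldFunction A ; Relation = OrderRelation }

  add⊆field : Inclusion L-add L-field
  add⊆field = record
    { onFunction = λ { 𝟘 → 𝟘 ; 𝟙 → 𝟙 ; plus → plus ; minus → minus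
                     ; (scale a) → scale a }
    ; onRelation = λ R → R
    }

  mult⊆field : Inclusion L-mult L-field
  mult⊆field = record
    { onFunction = λ { 𝟘 → 𝟘 ; 𝟙 → 𝟙 ; times → times ; divide → divide
                     ; (scale a) → scale a }
    ; onRelation = λ R → R
    }

module _ {ℓ} (ℝ : CompleteOrderedField ℓ) where
  open CompleteOrderedField ℝ

  module _ (F : Pred Carrier ℓ) where

    ∣F∣ : Set ℓ
    ∣F∣ = Σ Carrier F

    order : ∀ {m} → OrderRelation m → Vec Carrier m → Set ℓ
    order less (x ∷ y ∷ []) = x < y

    ℝ-add : Structure (L-add ∣F∣)
    ℝ-add = record
      { Carrier  = Carrier
      ; equality = _≈_
      ; function = λ { 𝟘               []           → 0#
                     ; 𝟙               []           → 1#
                     ; plus            (x ∷ y ∷ []) → x + y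
                     ; minus           (x ∷ y ∷ []) → x - y
                     ; (scale (a , _)) (x ∷ [])     → a * x }
      ; relation = order
      }

    ℝ-mult : Structure (L-mult ∣F∣)
    ℝ-mult = record
      { Carrier  = Carrier
      ; equality = _≈_
      ; function = λ { 𝟘               []           → 0#
                     ; 𝟙               []           → 1#
                     ; times           (x ∷ y ∷ []) → x * y
                     ; divide          (x ∷ y ∷ []) → x ÷ y
                     ; (scale (a , _)) (x ∷ [])     → a * x }
      ; relation = order
      }

    T-add : Syntax.Theory (L-add ∣F∣)
    T-add = Semantics.Th ℝ-add

    T-mult : Syntax.Theory (L-mult ∣F∣)
    T-mult = Semantics.Th ℝ-mult

    T-union : Syntax.Theory (L-field ∣F∣)
    T-union = Translation.image (add⊆field ∣F∣) T-add
         ∪ Translation.image (mult⊆field ∣F∣) T-mult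

    valueAt : ∀ {k} → Polynomial ∣F∣ k → Vector Carrier k → Carrier
    valueAt = Evaluation.evaluate rawSemiring (λ (a , _) x → a * x)

    open Syntax (L-field ∣F∣)

    infix 8 _≤′_
    _≤′_ : ∀ {n} → Term n → Term n → Formula n
    s ≤′ t = rel less (s ∷ t ∷ []) ∨ s ≐ t

    0′ 1′ : ∀ {n} → Term n
    0′ = fun 𝟘 []
    1′ = fun 𝟙 []

    termRawSemiring : ℕ → RawSemiring ℓ ℓ
    termRawSemiring n = record
      { Carrier = Term n
      ; _≈_     = _≡_
      ; _+_     = λ s t → fun plus (s ∷ t ∷ [])
      ; _*_     = λ s t → fun times (s ∷ t ∷ [])
      ; 0#      = 0′
      ; 1#      = 1′
      }

    polynomialTerm : ∀ {k n} → Polynomial ∣F∣ k → Vector (Term n) k → Term n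
    polynomialTerm = Evaluation.evaluate (termRawSemiring _)
                       (λ a t → fun (scale a) (t ∷ []))

    -- The outermost of the k quantifiers binds x₁, hence `opposite`.
    variables : ∀ k → Vector (Term k) k
    variables k i = var (opposite i)

    nonvanishing : ∀ {k} → Polynomial ∣F∣ k → Sentence
    nonvanishing {k} p =
      ∀* (⋀ (λ i → 0′ ≤′ x i ∧ x i ≤′ 1′) ⇒ ¬′ (polynomialTerm p x ≐ 0′))
      where x = variables k

  UnitCube : ∀ k → Pred (Vector Carrier k) ℓ
  UnitCube k x = ∀ i → 0# ≤ x i × x i ≤ 1#

{-# OPTIONS --safe #-}

-- Soundness of natural deduction in ℝ gives one direction. For the other, interval arithmetic
-- is available in T[F]: that x + y or c x lies in an interval with endpoints in F because x
-- and y do is a sentence of T_add[F], and that x y does is, for intervals in [0,∞), one of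
-- T_mult[F]. Hence T[F] encloses the value of f on a box with endpoints in F in an interval whose width is at
-- most a constant times the size of the box, and so refutes f = 0 on every sufficiently small
-- box around a point where f is nonzero. Two boxes sharing a face are glued by the sentence
-- ∀x (x ≤ m ∨ m ≤ x) of T_add[F], so compactness of [0,1]^k yields a refutation on the whole cube.

module Submission where

open import Defs
open import Axiom.ExcludedMiddle using (ExcludedMiddle)
import Algebra.Definitions.RawSemiring as RawSemiringDefinitions
import Algebra.Properties.AbelianGroup as AbelianGroupProperties
import Algebra.Properties.Ring as RingProperties
import Algebra.Solver.Ring.NaturalCoefficients.Default as RingSolver
import Data.Empty.Polymorphic as Polymorphic
open import Data.Fin.Base using (zero; suc; opposite)
open import Data.Fin.Properties using (opposite-involutive) renaming (_≟_ to _≟ᶠ_)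
open import Data.List.Base as List using (List; []; _∷_)
open import Data.List.Relation.Binary.Subset.Propositional using (_⊆_)
open import Data.List.Relation.Binary.Subset.Propositional.Properties using (∷⁺ʳ; map⁺)
open import Data.List.Relation.Unary.All as All using (All; []; _∷_)
import Data.List.Relation.Unary.All.Properties as All
open import Data.List.Relation.Unary.Any using (here; there)
open import Data.Nat.Base using (ℕ; zero; suc)
open import Data.Product.Base using (Σ; ∃-syntax; _×_; _,_; proj₁; proj₂; map; map₂)
open import Data.Sum.Base as Sum using (inj₁; inj₂; [_,_]′)
open import Data.Vec.Base as Vec using (Vec; []; _∷_)
open import Data.Vec.Functional as Vector using (Vector)
open import Data.Vec.Properties using (lookup∘tabulate; lookup∘update; lookup∘update′; lookup-replicate)
open import Data.Vec.Relation.Binary.Pointwise.Inductive using (Pointwise; []; _∷_)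
open import Function.Base using (_∘_; id)
open import Function.Bundles using (_⇔_; mk⇔; Equivalence)
open import Level using (Level)
open import Relation.Binary.Bundles using (StrictTotalOrder)
open import Relation.Binary.Definitions using (tri<; tri≈; tri>)
import Relation.Binary.Properties.StrictTotalOrder as StrictTotalOrderProperties
open import Relation.Binary.PropositionalEquality as ≡ using (_≡_; refl; cong; cong₂)
import Relation.Binary.Reasoning.StrictPartialOrder as StrictReasoning
open import Relation.Binary.Structures using (IsEquivalence)
open import Relation.Nullary using (¬_; yes; no; contradiction)
open import Relation.Unary using (Pred)

open Equivalence using (to; from)

-- The obstacle is that no axiom of T[F] mentions both addition and multiplication; the distributive
-- law, for one, is not among them. Each step of a derivation must therefore instantiate a true
-- sentence of a single kind, although mixed terms may be put for its variables. Scaling, 1 and the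
-- order are common to both languages, so bounds by the terms f_a(1) are a currency that the two
-- sides can exchange. The choice of the intervals and all estimates of their widths are made in ℝ,
-- outside the formal system; a derivation receives only the resulting bounds. On the cube every
-- power product stays in [0,1]. So products are only ever taken of nonnegative intervals, and signs
-- matter only for the coefficients, whose scalings are additive symbols. The endpoints of boxes
-- have to lie in F, whereas the points at which f is known to be nonzero are arbitrary reals. The
-- covering argument must thus step across points that it cannot use as endpoints, for which
-- positive elements of F of arbitrarily small size suffice.

-- Substitution, weakening and universal closures.

module SyntaxProperties {ℓ : Level} (L : Language ℓ) where
  open Syntax L

  private variable
    m n o j : ℕ
    T : Theory

  mutual
    substTerm-cong : {σ τ : Substitution m n} → (∀ i → σ i ≡ τ i) →
                     ∀ t → substTerm σ t ≡ substTerm τ t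
    substTerm-cong eq (var i)    = eq i
    substTerm-cong eq (fun f ts) = cong (fun f) (substTerms-cong eq ts)

    substTerms-cong : {σ τ : Substitution m n} → (∀ i → σ i ≡ τ i) →
                      (ts : Vec (Term m) j) → substTerms σ ts ≡ substTerms τ ts
    substTerms-cong eq []       = refl
    substTerms-cong eq (t ∷ ts) = cong₂ _∷_ (substTerm-cong eq t) (substTerms-cong eq ts)

  mutual
    substTerm-var : (t : Term n) → substTerm var t ≡ t
    substTerm-var (var i)    = refl
    substTerm-var (fun f ts) = cong (fun f) (substTerms-var ts)

    substTerms-var : (ts : Vec (Term n) j) → substTerms var ts ≡ ts
    substTerms-var []       = refl
    substTerms-var (t ∷ ts) = cong₂ _∷_ (substTerm-var t) (substTerms-var ts)

  mutual
    substTerm-∘ : (τ : Substitution n o) (σ : Substitution m n) →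
                  ∀ t → substTerm τ (substTerm σ t) ≡ substTerm (substTerm τ ∘ σ) t
    substTerm-∘ τ σ (var i)    = refl
    substTerm-∘ τ σ (fun f ts) = cong (fun f) (substTerms-∘ τ σ ts)

    substTerms-∘ : (τ : Substitution n o) (σ : Substitution m n) (ts : Vec (Term m) j) →
                   substTerms τ (substTerms σ ts) ≡ substTerms (substTerm τ ∘ σ) ts
    substTerms-∘ τ σ []       = refl
    substTerms-∘ τ σ (t ∷ ts) = cong₂ _∷_ (substTerm-∘ τ σ t) (substTerms-∘ τ σ ts)

  lift-cong : {σ τ : Substitution m n} → (∀ i → σ i ≡ τ i) → ∀ i → lift σ i ≡ lift τ i
  lift-cong eq zero    = refl
  lift-cong eq (suc i) = cong (substTerm shift) (eq i)

  lift-∘ : (τ : Substitution n o) (σ : Substitution m n) →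
           ∀ i → substTerm (lift τ) (lift σ i) ≡ lift (substTerm τ ∘ σ) i
  lift-∘ τ σ zero    = refl
  lift-∘ τ σ (suc i) = ≡.trans (substTerm-∘ (lift τ) shift (σ i))
                               (≡.sym (substTerm-∘ shift τ (σ i)))

  subst-cong : {σ τ : Substitution m n} → (∀ i → σ i ≡ τ i) →
               ∀ φ → subst σ φ ≡ subst τ φ
  subst-cong eq (s ≐ t)    = cong₂ _≐_ (substTerm-cong eq s) (substTerm-cong eq t)
  subst-cong eq (rel R ts) = cong (rel R) (substTerms-cong eq ts)
  subst-cong eq ⊥′         = refl
  subst-cong eq (φ ∧ ψ)    = cong₂ _∧_ (subst-cong eq φ) (subst-cong eq ψ)
  subst-cong eq (φ ∨ ψ)    = cong₂ _∨_ (subst-cong eq φ) (subst-cong eq ψ)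
  subst-cong eq (φ ⇒ ψ)    = cong₂ _⇒_ (subst-cong eq φ) (subst-cong eq ψ)
  subst-cong eq (∀′ φ)     = cong ∀′ (subst-cong (lift-cong eq) φ)
  subst-cong eq (∃′ φ)     = cong ∃′ (subst-cong (lift-cong eq) φ)

  subst-∘ : (τ : Substitution n o) (σ : Substitution m n) →
            ∀ φ → subst τ (subst σ φ) ≡ subst (substTerm τ ∘ σ) φ
  subst-∘ τ σ (s ≐ t)    = cong₂ _≐_ (substTerm-∘ τ σ s) (substTerm-∘ τ σ t)
  subst-∘ τ σ (rel R ts) = cong (rel R) (substTerms-∘ τ σ ts)
  subst-∘ τ σ ⊥′         = refl
  subst-∘ τ σ (φ ∧ ψ)    = cong₂ _∧_ (subst-∘ τ σ φ) (subst-∘ τ σ ψ)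
  subst-∘ τ σ (φ ∨ ψ)    = cong₂ _∨_ (subst-∘ τ σ φ) (subst-∘ τ σ ψ)
  subst-∘ τ σ (φ ⇒ ψ)    = cong₂ _⇒_ (subst-∘ τ σ φ) (subst-∘ τ σ ψ)
  subst-∘ τ σ (∀′ φ)     = cong ∀′ (≡.trans (subst-∘ (lift τ) (lift σ) φ)
                                            (subst-cong (lift-∘ τ σ) φ))
  subst-∘ τ σ (∃′ φ)     = cong ∃′ (≡.trans (subst-∘ (lift τ) (lift σ) φ)
                                            (subst-cong (lift-∘ τ σ) φ))

  -- Instantiating a closure peels off quantifiers one at a time, so σ arrives in two stages: its
  -- values on the outer variables are substituted under the binder, and the value at zero follows
  -- by `∀-elim`. Weakening the former and then substituting for the fresh variable cancels.
  subst-lift-single : (σ : Substitution (suc m) n) →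
                      ∀ φ → subst (lift (σ ∘ suc)) φ [ σ zero ] ≡ subst σ φ
  subst-lift-single σ φ = ≡.trans (subst-∘ _ _ φ) (subst-cong eq φ)
    where
    eq : ∀ i → substTerm (single (σ zero)) (lift (σ ∘ suc) i) ≡ σ i
    eq zero    = refl
    eq (suc i) = ≡.trans (substTerm-∘ _ shift (σ (suc i))) (substTerm-var (σ (suc i)))

  -- Needed to carry the bounds that describe a box into the two branches of a case distinction.
  ⊢-mono : {Γ Δ : List (Formula n)} {φ : Formula n} →
           Γ ⊆ Δ → T ∣ Γ ⊢ φ → T ∣ Δ ⊢ φ
  ⊢-mono s (axiom x)       = axiom x
  ⊢-mono s (assume x)      = assume (s x)
  ⊢-mono s (raa p)         = raa (⊢-mono (∷⁺ʳ _ s) p)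
  ⊢-mono s (∧-intro p q)   = ∧-intro (⊢-mono s p) (⊢-mono s q)
  ⊢-mono s (∧-elim₁ p)     = ∧-elim₁ (⊢-mono s p)
  ⊢-mono s (∧-elim₂ p)     = ∧-elim₂ (⊢-mono s p)
  ⊢-mono s (∨-intro₁ p)    = ∨-intro₁ (⊢-mono s p)
  ⊢-mono s (∨-intro₂ p)    = ∨-intro₂ (⊢-mono s p)
  ⊢-mono s (∨-elim p q r)  = ∨-elim (⊢-mono s p) (⊢-mono (∷⁺ʳ _ s) q) (⊢-mono (∷⁺ʳ _ s) r)
  ⊢-mono s (⇒-intro p)     = ⇒-intro (⊢-mono (∷⁺ʳ _ s) p)
  ⊢-mono s (⇒-elim p q)    = ⇒-elim (⊢-mono s p) (⊢-mono s q)
  ⊢-mono s (∀-intro p)     = ∀-intro (⊢-mono (map⁺ weaken s) p)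
  ⊢-mono s (∀-elim p t)    = ∀-elim (⊢-mono s p) t
  ⊢-mono s (∃-intro t p)   = ∃-intro t (⊢-mono s p)
  ⊢-mono s (∃-elim p q)    = ∃-elim (⊢-mono s p) (⊢-mono (∷⁺ʳ _ (map⁺ weaken s)) q)
  ⊢-mono s (≐-refl t)      = ≐-refl t
  ⊢-mono s (≐-subst φ p q) = ≐-subst φ (⊢-mono s p) (⊢-mono s q)

  ∀*-intro : {φ : Formula n} → T ∣ [] ⊢ φ → T ⊢ ∀* φ
  ∀*-intro {n = zero}  p = p
  ∀*-intro {n = suc n} p = ∀*-intro (∀-intro p)

  -- The rule `axiom` delivers a closed sentence under an empty substitution. Two such functions
  -- agree only pointwise, so τ is left arbitrary and is replaced at the end of the recursion.
  ∀*-elim : {Γ : List (Formula m)} {τ : Substitution 0 m} (φ : Formula n) →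
            T ∣ Γ ⊢ subst τ (∀* φ) → (σ : Substitution n m) → T ∣ Γ ⊢ subst σ φ
  ∀*-elim {n = zero}  {T = T} {Γ = Γ} φ p σ =
    ≡.subst (T ∣ Γ ⊢_) (subst-cong (λ ()) φ) p
  ∀*-elim {n = suc n} {T = T} {Γ = Γ} φ p σ =
    ≡.subst (T ∣ Γ ⊢_) (subst-lift-single σ φ)
      (∀-elim (∀*-elim (∀′ φ) p (σ ∘ suc)) (σ zero))

  ⋀-elim : ∀ {k} {Γ : List (Formula n)} (φ : Vector (Formula n) k) →
           T ∣ Γ ⊢ ⋀ φ → ∀ i → T ∣ Γ ⊢ φ i
  ⋀-elim φ p zero    = ∧-elim₁ p
  ⋀-elim φ p (suc i) = ⋀-elim (φ ∘ suc) (∧-elim₂ p) i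

-- Truth of closures and conjunctions.

module SemanticsProperties {ℓ : Level} {L : Language ℓ} (S : Structure L) where
  open Syntax L
  open Structure S
  open Semantics S

  ∀*-valid : ∀ {n} (φ : Formula n) → (∀ ρ → Holds ρ φ) → Holds [] (∀* φ)
  ∀*-valid {zero}  φ h = h []
  ∀*-valid {suc n} φ h = ∀*-valid (∀′ φ) (λ ρ x → h (x ∷ ρ))

  ∀*-holds : ∀ {n} (φ : Formula n) → Holds [] (∀* φ) → ∀ ρ → Holds ρ φ
  ∀*-holds {zero}  φ h []      = h
  ∀*-holds {suc n} φ h (x ∷ ρ) = ∀*-holds (∀′ φ) h ρ x

  ⋀-holds : ∀ {n k} {ρ : Vec Carrier n} (φ : Vector (Formula n) k) →
            (∀ i → Holds ρ (φ i)) → Holds ρ (⋀ φ)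
  ⋀-holds {k = zero}  φ h = id
  ⋀-holds {k = suc k} φ h = h zero , ⋀-holds (φ ∘ suc) (h ∘ suc)

-- Soundness of natural deduction when equality is a congruence.

module Soundness
  {ℓ : Level} (em : ExcludedMiddle ℓ) {L : Language ℓ} (S : Structure L)
  (isEquivalence : IsEquivalence (Structure.equality S))
  (function-cong : ∀ {m} (f : Language.Function L m) {xs ys : Vec (Structure.Carrier S) m} →
                   Pointwise (Structure.equality S) xs ys →
                   Structure.equality S (Structure.function S f xs) (Structure.function S f ys))
  (relation-resp : ∀ {m} (R : Language.Relation L m) {xs ys : Vec (Structure.Carrier S) m} →
                   Pointwise (Structure.equality S) xs ys →
                   Structure.relation S R xs → Structure.relation S R ys)
  where
  open Structure S
  open Syntax L
  open Semantics S
  private module Eq = IsEquivalence isEquivalence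

  private variable
    m n j : ℕ

  Pointwise-sym : {xs ys : Vec Carrier m} → Pointwise equality xs ys → Pointwise equality ys xs
  Pointwise-sym []       = []
  Pointwise-sym (e ∷ es) = Eq.sym e ∷ Pointwise-sym es

  -- Agreement is only up to the equality of the structure. This is what `≐-subst` needs: when s and
  -- t have equal values, one and the same environment is represented both by `single s` and by
  -- `single t`.
  Represents : Substitution m n → Vec Carrier n → Vec Carrier m → Set ℓ
  Represents σ ρ ρ′ = ∀ i → equality (Vec.lookup ρ′ i) (valueTerm ρ (σ i))

  mutual
    valueTerm-subst : {σ : Substitution m n} {ρ : Vec Carrier n} {ρ′ : Vec Carrier m} →
                      Represents σ ρ ρ′ →
                      ∀ t → equality (valueTerm ρ′ t) (valueTerm ρ (substTerm σ t))
    valueTerm-subst e (var i)    = e i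
    valueTerm-subst e (fun f ts) = function-cong f (valueTerms-subst e ts)

    valueTerms-subst : {σ : Substitution m n} {ρ : Vec Carrier n} {ρ′ : Vec Carrier m} →
                       Represents σ ρ ρ′ → (ts : Vec (Term m) j) →
                       Pointwise equality (valueTerms ρ′ ts) (valueTerms ρ (substTerms σ ts))
    valueTerms-subst e []       = []
    valueTerms-subst e (t ∷ ts) = valueTerm-subst e t ∷ valueTerms-subst e ts

  Represents-lift : {σ : Substitution m n} {ρ : Vec Carrier n} {ρ′ : Vec Carrier m} →
                    Represents σ ρ ρ′ → ∀ x → Represents (lift σ) (x ∷ ρ) (x ∷ ρ′)
  Represents-lift         e x zero    = Eq.refl
  Represents-lift {σ = σ} e x (suc i) =
    Eq.trans (e i) (valueTerm-subst (λ _ → Eq.refl) (σ i))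

  Represents-single : (ρ : Vec Carrier n) (t : Term n) {x : Carrier} →
                      equality x (valueTerm ρ t) → Represents (single t) ρ (x ∷ ρ)
  Represents-single ρ t e zero    = e
  Represents-single ρ t e (suc i) = Eq.refl

  -- An equivalence is proved because an implication uses its premise in the opposite direction.
  Holds-subst : {σ : Substitution m n} {ρ : Vec Carrier n} {ρ′ : Vec Carrier m} →
                Represents σ ρ ρ′ → ∀ φ → Holds ρ′ φ ⇔ Holds ρ (subst σ φ)
  Holds-subst e (s ≐ t) = mk⇔
    (λ h → Eq.trans (Eq.sym (valueTerm-subst e s)) (Eq.trans h (valueTerm-subst e t)))
    (λ h → Eq.trans (valueTerm-subst e s) (Eq.trans h (Eq.sym (valueTerm-subst e t))))
  Holds-subst e (rel R ts) = mk⇔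
    (relation-resp R (valueTerms-subst e ts))
    (relation-resp R (Pointwise-sym (valueTerms-subst e ts)))
  Holds-subst e ⊥′ = mk⇔ id id
  Holds-subst e (φ ∧ ψ) with Holds-subst e φ | Holds-subst e ψ
  ... | p | q = mk⇔ (map (to p) (to q)) (map (from p) (from q))
  Holds-subst e (φ ∨ ψ) with Holds-subst e φ | Holds-subst e ψ
  ... | p | q = mk⇔ (Sum.map (to p) (to q)) (Sum.map (from p) (from q))
  Holds-subst e (φ ⇒ ψ) with Holds-subst e φ | Holds-subst e ψ
  ... | p | q = mk⇔ (λ h → to q ∘ h ∘ from p) (λ h → from q ∘ h ∘ to p)
  Holds-subst e (∀′ φ) = mk⇔
    (λ h x → to   (Holds-subst (Represents-lift e x) φ) (h x))
    (λ h x → from (Holds-subst (Represents-lift e x) φ) (h x))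
  Holds-subst e (∃′ φ) = mk⇔
    (map₂ λ {x} → to   (Holds-subst (Represents-lift e x) φ))
    (map₂ λ {x} → from (Holds-subst (Represents-lift e x) φ))

  Holds-weaken : {ρ : Vec Carrier n} {x : Carrier} {Γ : List (Formula n)} →
                 All (Holds ρ) Γ → All (Holds (x ∷ ρ)) (List.map weaken Γ)
  Holds-weaken = All.map⁺ ∘ All.map (λ {φ} → to (Holds-subst (λ _ → Eq.refl) φ))

  sound : {T : Theory} → (∀ {φ} → T φ → Holds [] φ) →
          {Γ : List (Formula n)} {φ : Formula n} → T ∣ Γ ⊢ φ →
          ∀ ρ → All (Holds ρ) Γ → Holds ρ φ
  sound M (axiom {φ} x)     ρ h = to (Holds-subst (λ ()) φ) (M x)
  sound M (assume x)        ρ h = All.lookup h x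
  sound M (raa {φ} p)       ρ h with em {Holds ρ φ}
  ... | yes y = y
  ... | no  n = Polymorphic.⊥-elim (sound M p ρ ((λ y → contradiction y n) ∷ h))
  sound M (∧-intro p q)     ρ h = sound M p ρ h , sound M q ρ h
  sound M (∧-elim₁ p)       ρ h = proj₁ (sound M p ρ h)
  sound M (∧-elim₂ p)       ρ h = proj₂ (sound M p ρ h)
  sound M (∨-intro₁ p)      ρ h = inj₁ (sound M p ρ h)
  sound M (∨-intro₂ p)      ρ h = inj₂ (sound M p ρ h)
  sound M (∨-elim p q r)    ρ h = [ (λ y → sound M q ρ (y ∷ h)) , (λ y → sound M r ρ (y ∷ h)) ]′
                                    (sound M p ρ h)
  sound M (⇒-intro p)       ρ h = λ y → sound M p ρ (y ∷ h)
  sound M (⇒-elim p q)      ρ h = sound M p ρ h (sound M q ρ h)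
  sound M (∀-intro p)       ρ h = λ x → sound M p (x ∷ ρ) (Holds-weaken h)
  sound M (∀-elim {φ} p t)  ρ h =
    to (Holds-subst (Represents-single ρ t Eq.refl) φ) (sound M p ρ h (valueTerm ρ t))
  sound M (∃-intro {φ} t p) ρ h =
    valueTerm ρ t , from (Holds-subst (Represents-single ρ t Eq.refl) φ) (sound M p ρ h)
  sound M (∃-elim {χ = χ} p q) ρ h with sound M p ρ h
  ... | x , y = from (Holds-subst (λ _ → Eq.refl) χ) (sound M q (x ∷ ρ) (y ∷ Holds-weaken h))
  sound M (≐-refl t)        ρ h = Eq.refl
  sound M (≐-subst φ {s} {t} p q) ρ h =
    to (Holds-subst {ρ′ = valueTerm ρ s ∷ ρ} (Represents-single ρ t (sound M p ρ h)) φ)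
      (from (Holds-subst (Represents-single ρ s Eq.refl) φ) (sound M q ρ h))

-- Truth in a reduct and in its expansion.

module Reduct
  {ℓ : Level} {L M : Language ℓ} (ι : Inclusion L M)
  (S : Structure L)
  (functionM : ∀ {m} → Language.Function M m → Vec (Structure.Carrier S) m → Structure.Carrier S)
  (relationM : ∀ {m} → Language.Relation M m → Vec (Structure.Carrier S) m → Set ℓ)
  (function-≡ : ∀ {m} (f : Language.Function L m) xs →
                Structure.function S f xs ≡ functionM (Inclusion.onFunction ι f) xs)
  (relation-≡ : ∀ {m} (R : Language.Relation L m) xs →
                Structure.relation S R xs ≡ relationM (Inclusion.onRelation ι R) xs)
  where
  open Inclusion ι
  open Structure S
  open Syntax L
  open Translation ι

  expansion : Structure M
  expansion = record
    { Carrier = Carrier ; equality = equality ; function = functionM ; relation = relationM }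

  private
    module SL = Semantics S
    module SM = Semantics expansion

  private variable
    n j : ℕ

  mutual
    valueTerm-translate : (ρ : Vec Carrier n) →
                          ∀ t → SL.valueTerm ρ t ≡ SM.valueTerm ρ (translateTerm t)
    valueTerm-translate ρ (var i)    = refl
    valueTerm-translate ρ (fun f ts) =
      ≡.trans (function-≡ f _) (cong (functionM (onFunction f)) (valueTerms-translate ρ ts))

    valueTerms-translate : (ρ : Vec Carrier n) (ts : Vec (Term n) j) →
                           SL.valueTerms ρ ts ≡ SM.valueTerms ρ (translateTerms ts)
    valueTerms-translate ρ []       = refl
    valueTerms-translate ρ (t ∷ ts) =
      cong₂ _∷_ (valueTerm-translate ρ t) (valueTerms-translate ρ ts)

  Holds-translate : (ρ : Vec Carrier n) → ∀ φ → SL.Holds ρ φ ⇔ SM.Holds ρ (translate φ)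
  Holds-translate ρ (s ≐ t) = mk⇔ (≡.subst id eq) (≡.subst id (≡.sym eq))
    where eq = cong₂ equality (valueTerm-translate ρ s) (valueTerm-translate ρ t)
  Holds-translate ρ (rel R ts) = mk⇔ (≡.subst id eq) (≡.subst id (≡.sym eq))
    where eq = ≡.trans (relation-≡ R _) (cong (relationM (onRelation R)) (valueTerms-translate ρ ts))
  Holds-translate ρ ⊥′ = mk⇔ id id
  Holds-translate ρ (φ ∧ ψ) with Holds-translate ρ φ | Holds-translate ρ ψ
  ... | p | q = mk⇔ (map (to p) (to q)) (map (from p) (from q))
  Holds-translate ρ (φ ∨ ψ) with Holds-translate ρ φ | Holds-translate ρ ψ
  ... | p | q = mk⇔ (Sum.map (to p) (to q)) (Sum.map (from p) (from q))
  Holds-translate ρ (φ ⇒ ψ) with Holds-translate ρ φ | Holds-translate ρ ψ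
  ... | p | q = mk⇔ (λ h → to q ∘ h ∘ from p) (λ h → from q ∘ h ∘ to p)
  Holds-translate ρ (∀′ φ) = mk⇔
    (λ h x → to   (Holds-translate (x ∷ ρ) φ) (h x))
    (λ h x → from (Holds-translate (x ∷ ρ) φ) (h x))
  Holds-translate ρ (∃′ φ) = mk⇔
    (map₂ λ {x} → to   (Holds-translate (x ∷ ρ) φ))
    (map₂ λ {x} → from (Holds-translate (x ∷ ρ) φ))

-- Deriving instances of formulas valid in a reduct.

module TranslationProperties {ℓ : Level} {L M : Language ℓ} (ι : Inclusion L M) where
  open Translation ι
  private
    module L = Syntax L
    module M = Syntax M

  translate-∀* : ∀ {n} (φ : L.Formula n) → translate (L.∀* φ) ≡ M.∀* (translate φ)
  translate-∀* {zero}  φ = refl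
  translate-∀* {suc n} φ = translate-∀* (L.∀′ φ)

  -- The universal closure of φ is true in S, hence its translation is an axiom, and it can be
  -- instantiated at any terms of the larger language. In this way an additive fact becomes
  -- applicable to terms that contain products.
  ⊢-valid : (S : Structure L) {T : M.Theory} → (∀ {φ} → image (Semantics.Th S) φ → T φ) →
            ∀ {m n} {Γ : List (M.Formula m)} (φ : L.Formula n) →
            (∀ ρ → Semantics.Holds S ρ φ) →
            (σ : M.Substitution n m) → M._∣_⊢_ T Γ (M.subst σ (translate φ))
  ⊢-valid S {T} T-image φ valid = SyntaxProperties.∀*-elim M (translate φ)
    (M.axiom (≡.subst T (translate-∀* φ)
      (T-image (L.∀* φ , SemanticsProperties.∀*-valid S φ valid , refl))))

-- Inequalities in ordered fields.

module OrderedFieldProperties {ℓ : Level} (ℝ : CompleteOrderedField ℓ) where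
  open CompleteOrderedField ℝ hiding (zero) renaming (refl to ≈-refl)

  strictTotalOrder : StrictTotalOrder ℓ ℓ ℓ
  strictTotalOrder = record { isStrictTotalOrder = isStrictTotalOrder }

  open StrictTotalOrder strictTotalOrder public
    using (strictPartialOrder; <-respʳ-≈; <-respˡ-≈) renaming (irrefl to <-irrefl)
  open StrictTotalOrderProperties strictTotalOrder public
    using () renaming (total to ≤-total; trans to ≤-trans; refl to ≤-refl)
  open AbelianGroupProperties +-abelianGroup using (xyx⁻¹≈y; ⁻¹-involutive)
  open RingProperties ring using (-1*x≈-x)
  open RingSolver commutativeSemiring using (solve; _:+_; _:*_; _:=_)
  open StrictReasoning strictPartialOrder

  private variable
    x y z w : Carrier

  ≮⇒≥ : ¬ x < y → y ≤ x
  ≮⇒≥ {x} {y} x≮y with compare x y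
  ... | tri< x<y _ _ = contradiction x<y x≮y
  ... | tri≈ _ x≈y _ = inj₂ (sym x≈y)
  ... | tri> _ _ y<x = inj₁ y<x

  <⇒≱ : x < y → ¬ y ≤ x
  <⇒≱ {x} {y} x<y y≤x = <-irrefl (≈-refl) (begin-strict x <⟨ x<y ⟩ y ≤⟨ y≤x ⟩ x ∎)

  +-monoʳ-< : ∀ z → x < y → z + x < z + y
  +-monoʳ-< {x} {y} z x<y = begin-strict
    z + x  ≈⟨ +-comm z x ⟩
    x + z  <⟨ +-monoˡ-< z x<y ⟩
    y + z  ≈⟨ +-comm y z ⟩
    z + y  ∎

  +-monoˡ-≤ : ∀ z → x ≤ y → x + z ≤ y + z
  +-monoˡ-≤ z = Sum.map (+-monoˡ-< z) +-congʳ

  +-monoʳ-≤ : ∀ z → x ≤ y → z + x ≤ z + y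
  +-monoʳ-≤ z = Sum.map (+-monoʳ-< z) +-congˡ

  +-mono-≤ : x ≤ y → z ≤ w → x + z ≤ y + w
  +-mono-≤ {x} {y} {z} {w} x≤y z≤w = begin
    x + z  ≤⟨ +-monoˡ-≤ z x≤y ⟩
    y + z  ≤⟨ +-monoʳ-≤ y z≤w ⟩
    y + w  ∎

  x+[y-x]≈y : ∀ x y → x + (y - x) ≈ y
  x+[y-x]≈y x y = trans (sym (+-assoc x y (- x))) (xyx⁻¹≈y x y)

  +-cancelʳ-≤ : ∀ z → x + z ≤ y + z → x ≤ y
  +-cancelʳ-≤ {x} {y} z x+z≤y+z = begin
    x            ≈⟨ cancel x ⟨
    x + z - z    ≤⟨ +-monoˡ-≤ (- z) x+z≤y+z ⟩
    y + z - z    ≈⟨ cancel y ⟩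
    y            ∎
    where
    cancel : ∀ u → u + z - z ≈ u
    cancel u = trans (+-assoc u z (- z)) (trans (+-congˡ (-‿inverseʳ z)) (+-identityʳ u))

  +-cancelʳ-< : ∀ z → x + z < y + z → x < y
  +-cancelʳ-< {x} {y} z x+z<y+z with compare x y
  ... | tri< x<y _ _ = x<y
  ... | tri≈ _ x≈y _ = contradiction (inj₂ (+-congʳ (sym x≈y))) (<⇒≱ x+z<y+z)
  ... | tri> _ _ y<x = contradiction (inj₁ (+-monoˡ-< z y<x)) (<⇒≱ x+z<y+z)

  +-nonneg : 0# ≤ x → 0# ≤ y → 0# ≤ x + y
  +-nonneg {x} {y} 0≤x 0≤y = begin
    0#       ≈⟨ +-identityˡ 0# ⟨
    0# + 0#  ≤⟨ +-mono-≤ 0≤x 0≤y ⟩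
    x + y    ∎

  x≤x+y : 0# ≤ y → x ≤ x + y
  x≤x+y {y} {x} 0≤y = begin
    x       ≈⟨ +-identityʳ x ⟨
    x + 0#  ≤⟨ +-monoʳ-≤ x 0≤y ⟩
    x + y   ∎

  x<0⇒0<-x : x < 0# → 0# < - x
  x<0⇒0<-x {x} x<0 = begin-strict
    0#      ≈⟨ -‿inverseʳ x ⟨
    x - x   <⟨ +-monoˡ-< (- x) x<0 ⟩
    0# - x  ≈⟨ +-identityˡ (- x) ⟩
    - x     ∎

  x≤0⇒0≤-x : x ≤ 0# → 0# ≤ - x
  x≤0⇒0≤-x {x} x≤0 = begin
    0#      ≈⟨ -‿inverseʳ x ⟨
    x - x   ≤⟨ +-monoˡ-≤ (- x) x≤0 ⟩
    0# - x  ≈⟨ +-identityˡ (- x) ⟩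
    - x     ∎

  0<1 : 0# < 1#
  0<1 with compare 0# 1#
  ... | tri< p _ _ = p
  ... | tri≈ _ p _ = contradiction p 0≉1
  ... | tri> _ _ p = begin-strict
    0#           <⟨ *-positive (x<0⇒0<-x p) (x<0⇒0<-x p) ⟩
    - 1# * - 1#  ≈⟨ -1*x≈-x (- 1#) ⟩
    - - 1#       ≈⟨ ⁻¹-involutive 1# ⟩
    1#           ∎

  *-monoʳ-< : 0# < z → x < y → z * x < z * y
  *-monoʳ-< {z} {x} {y} 0<z x<y = begin-strict
    z * x                ≈⟨ +-identityʳ (z * x) ⟨
    z * x + 0#           <⟨ +-monoʳ-< (z * x) (*-positive 0<z 0<y-x) ⟩
    z * x + z * (y - x)  ≈⟨ distribˡ z x (y - x) ⟨
    z * (x + (y - x))    ≈⟨ *-congˡ (x+[y-x]≈y x y) ⟩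
    z * y                ∎
    where
    0<y-x : 0# < y - x
    0<y-x = begin-strict
      0#     ≈⟨ -‿inverseʳ x ⟨
      x - x  <⟨ +-monoˡ-< (- x) x<y ⟩
      y - x  ∎

  *-monoʳ-≤ : 0# ≤ z → x ≤ y → z * x ≤ z * y
  *-monoʳ-≤ (inj₁ 0<z) (inj₁ x<y) = inj₁ (*-monoʳ-< 0<z x<y)
  *-monoʳ-≤ _          (inj₂ x≈y) = inj₂ (*-congˡ x≈y)
  *-monoʳ-≤ {z} {x} {y} (inj₂ 0≈z) _ = inj₂ (trans (absorb x) (sym (absorb y)))
    where
    absorb : ∀ u → z * u ≈ 0#
    absorb u = trans (*-congʳ (sym 0≈z)) (zeroˡ u)

  *-monoˡ-≤ : 0# ≤ z → x ≤ y → x * z ≤ y * z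
  *-monoˡ-≤ {z} {x} {y} 0≤z x≤y = begin
    x * z  ≈⟨ *-comm x z ⟩
    z * x  ≤⟨ *-monoʳ-≤ 0≤z x≤y ⟩
    z * y  ≈⟨ *-comm z y ⟩
    y * z  ∎

  *-mono-≤ : 0# ≤ y → 0# ≤ z → x ≤ y → z ≤ w → x * z ≤ y * w
  *-mono-≤ {y} {z} {x} {w} 0≤y 0≤z x≤y z≤w = begin
    x * z  ≤⟨ *-monoˡ-≤ 0≤z x≤y ⟩
    y * z  ≤⟨ *-monoʳ-≤ 0≤y z≤w ⟩
    y * w  ∎

  *-nonneg : 0# ≤ x → 0# ≤ y → 0# ≤ x * y
  *-nonneg {x} {y} 0≤x 0≤y = begin
    0#      ≈⟨ zeroʳ x ⟨
    x * 0#  ≤⟨ *-monoʳ-≤ 0≤x 0≤y ⟩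
    x * y   ∎

  *-≤-1 : 0# ≤ y → x ≤ 1# → y ≤ 1# → x * y ≤ 1#
  *-≤-1 {y} {x} 0≤y x≤1 y≤1 = begin
    x * y   ≤⟨ *-mono-≤ (inj₁ 0<1) 0≤y x≤1 y≤1 ⟩
    1# * 1# ≈⟨ *-identityˡ 1# ⟩
    1#      ∎

  -- The solver works in a commutative semiring, where - s is an atom unrelated to s. Inserting this
  -- vanishing summand by hand, and removing it afterwards, reduces the remaining rearrangements to
  -- semiring identities.
  +-inverse-absorb : ∀ s x y → y + (- s + s) * x ≈ y
  +-inverse-absorb s x y = trans (+-congˡ (trans (*-congʳ (-‿inverseˡ s)) (zeroˡ x))) (+-identityʳ y)

  *-antimonoʳ-≤ : z ≤ 0# → x ≤ y → z * y ≤ z * x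
  *-antimonoʳ-≤ {z} {x} {y} z≤0 x≤y = begin
    z * y                      ≈⟨ +-inverse-absorb z x (z * y) ⟨
    z * y + (- z + z) * x      ≈⟨ solve 4 (λ z -z x y → z :* y :+ (-z :+ z) :* x
                                    := -z :* x :+ (z :* x :+ z :* y)) ≈-refl z (- z) x y ⟩
    - z * x + (z * x + z * y)  ≤⟨ +-monoˡ-≤ _ (*-monoʳ-≤ (x≤0⇒0≤-x z≤0) x≤y) ⟩
    - z * y + (z * x + z * y)  ≈⟨ solve 4 (λ z -z x y → -z :* y :+ (z :* x :+ z :* y)
                                    := z :* x :+ (-z :+ z) :* y) ≈-refl z (- z) x y ⟩
    z * x + (- z + z) * y      ≈⟨ +-inverse-absorb z y (z * x) ⟩
    z * x                      ∎

  inverse-positive : 0# < x → x * y ≈ 1# → 0# < y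
  inverse-positive {x} {y} 0<x xy≈1 with compare 0# y
  ... | tri< 0<y _ _ = 0<y
  ... | tri≈ _ 0≈y _ =
    contradiction (trans (sym (zeroʳ x)) (trans (*-congˡ 0≈y) xy≈1)) 0≉1
  ... | tri> _ _ y<0 = contradiction (inj₁ 1<0) (<⇒≱ 0<1)
    where
    1<0 : 1# < 0#
    1<0 = begin-strict
      1#      ≈⟨ xy≈1 ⟨
      x * y   <⟨ *-monoʳ-< 0<x y<0 ⟩
      x * 0#  ≈⟨ zeroʳ x ⟩
      0#      ∎

  positive⇒inverse : 0# < x → ∃[ y ] 0# < y × x * y ≈ 1#
  positive⇒inverse {x} 0<x with inverse x (λ x≈0 → <-irrefl (sym x≈0) 0<x)
  ... | y , xy≈1 = y , inverse-positive 0<x xy≈1 , xy≈1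

  -- The witness is y / (1 + x): the added 1 keeps the denominator positive when x is zero, and z +
  -- x z = y shows that x z falls short of y by z.
  scale-below : 0# ≤ x → 0# < y → ∃[ z ] 0# < z × x * z < y
  scale-below {x} {y} 0≤x 0<y with positive⇒inverse 0<1+x
    where
    0<1+x : 0# < 1# + x
    0<1+x = begin-strict
      0#      <⟨ 0<1 ⟩
      1#      ≤⟨ x≤x+y 0≤x ⟩
      1# + x  ∎
  ... | u , 0<u , [1+x]u≈1 = u * y , 0<uy , (begin-strict
    x * (u * y)             ≈⟨ +-identityˡ _ ⟨
    0# + x * (u * y)        <⟨ +-monoˡ-< _ 0<uy ⟩
    u * y + x * (u * y)     ≈⟨ +-congʳ (*-identityˡ _) ⟨
    1# * (u * y) + x * (u * y) ≈⟨ distribʳ (u * y) 1# x ⟨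
    (1# + x) * (u * y)      ≈⟨ *-assoc (1# + x) u y ⟨
    (1# + x) * u * y        ≈⟨ *-congʳ [1+x]u≈1 ⟩
    1# * y                  ≈⟨ *-identityˡ y ⟩
    y                       ∎)
    where
    0<uy : 0# < u * y
    0<uy = *-positive 0<u 0<y

  inverse-unique : ∀ {x x′ y y′} → x ≈ x′ → x * y ≈ 1# → x′ * y′ ≈ 1# → y ≈ y′
  inverse-unique {x} {x′} {y} {y′} x≈x′ xy≈1 x′y′≈1 = begin-equality
    y            ≈⟨ *-identityʳ y ⟨
    y * 1#       ≈⟨ *-congˡ x′y′≈1 ⟨
    y * (x′ * y′) ≈⟨ *-congˡ (*-congʳ x≈x′) ⟨
    y * (x * y′) ≈⟨ *-assoc y x y′ ⟨
    y * x * y′   ≈⟨ *-congʳ (trans (*-comm y x) xy≈1) ⟩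
    1# * y′      ≈⟨ *-identityˡ y′ ⟩
    y′           ∎

  ÷-cong : ∀ {x x′ y y′} → x ≈ x′ → y ≈ y′ → x ÷ y ≈ x′ ÷ y′
  ÷-cong {y = y} {y′ = y′} x≈x′ y≈y′ with y ≟ 0# | y′ ≟ 0#
  ... | yes _   | yes _    = ≈-refl
  ... | yes y≈0 | no y′≉0  = contradiction (trans (sym y≈y′) y≈0) y′≉0
  ... | no y≉0  | yes y′≈0 = contradiction (trans y≈y′ y′≈0) y≉0
  ... | no y≉0  | no y′≉0  =
    *-cong x≈x′ (inverse-unique y≈y′ (proj₂ (inverse y y≉0)) (proj₂ (inverse y′ y′≉0)))

-- Small elements of F, intervals with endpoints in F, and compactness of the cube.

module SubfieldProperties
  {ℓ : Level} (em : ExcludedMiddle ℓ) (ℝ : CompleteOrderedField ℓ)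
  {F : Pred (CompleteOrderedField.Carrier ℝ) ℓ} (F-isSubfield : IsSubfield ℝ F) where
  open CompleteOrderedField ℝ hiding (zero) renaming (refl to ≈-refl)
  open OrderedFieldProperties ℝ
  open IsSubfield F-isSubfield
  open StrictReasoning strictPartialOrder

  -- The Archimedean argument with F in place of the natural numbers: F is closed under adding 1, so
  -- if it were bounded with supremum s, then s - 1 would bound it as well.
  unbounded : ∀ x → ∃[ g ] F g × x < g
  unbounded x with em {∃[ g ] F g × x < g}
  ... | yes p = p
  ... | no ¬p with complete F (0# , 0-closed) (x , λ g Fg → ≮⇒≥ (λ x<g → ¬p (g , Fg , x<g)))
  ... | s , s-upper , s-least = contradiction s+1≤s (<⇒≱ s<s+1)
    where
    s<s+1 : s < s + 1#
    s<s+1 = begin-strict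
      s       ≈⟨ +-identityʳ s ⟨
      s + 0#  <⟨ +-monoʳ-< s 0<1 ⟩
      s + 1#  ∎

    s-1-upper : UpperBound F (s - 1#)
    s-1-upper g Fg = +-cancelʳ-≤ 1# (begin
      g + 1#       ≤⟨ s-upper (g + 1#) (+-closed Fg 1-closed) ⟩
      s            ≈⟨ x+[y-x]≈y 1# s ⟨
      1# + (s - 1#) ≈⟨ +-comm 1# (s - 1#) ⟩
      s - 1# + 1#  ∎)

    s+1≤s : s + 1# ≤ s
    s+1≤s = begin
      s + 1#       ≤⟨ +-monoˡ-≤ 1# (s-least (s - 1#) s-1-upper) ⟩
      s - 1# + 1#  ≈⟨ +-comm (s - 1#) 1# ⟩
      1# + (s - 1#) ≈⟨ x+[y-x]≈y 1# s ⟩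
      s            ∎

  -- The witness is 1/g, for g in F above 1/ε.
  arbitrarilySmall : ∀ {ε} → 0# < ε → ∃[ d ] F d × 0# < d × d ≤ ε
  arbitrarilySmall {ε} 0<ε with positive⇒inverse 0<ε
  ... | y , 0<y , εy≈1 with unbounded y
  ... | g , Fg , y<g with positive⇒inverse (begin-strict 0# <⟨ 0<y ⟩ y <⟨ y<g ⟩ g ∎)
  ... | d , 0<d , gd≈1 = d , ⁻¹-closed Fg gd≈1 , 0<d , (begin
    d            ≈⟨ *-identityʳ d ⟨
    d * 1#       ≈⟨ *-congˡ εy≈1 ⟨
    d * (ε * y)  ≤⟨ *-monoʳ-≤ (inj₁ 0<d) (*-monoʳ-≤ (inj₁ 0<ε) (inj₁ y<g)) ⟩
    d * (ε * g)  ≈⟨ *-congˡ (*-comm ε g) ⟩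
    d * (g * ε)  ≈⟨ *-assoc d g ε ⟨
    d * g * ε    ≈⟨ *-congʳ (trans (*-comm d g) gd≈1) ⟩
    1# * ε       ≈⟨ *-identityˡ ε ⟩
    ε            ∎)

  Interval : Set ℓ
  Interval = ∣F∣ ℝ F × ∣F∣ ℝ F

  lower upper : Interval → Carrier
  lower ((a , _) , _) = a
  upper (_ , (b , _)) = b

  0F 1F : ∣F∣ ℝ F
  0F = 0# , 0-closed
  1F = 1# , 1-closed

  -- The width is bounded without subtraction, so that estimates of it stay within reach of the
  -- semiring solver.
  record Encloses (x ε : Carrier) (I : Interval) : Set ℓ where
    constructor encloses
    field
      lower≤ : lower I ≤ x
      ≤upper : x ≤ upper I
      width  : upper I ≤ lower I + ε

  Unit : Pred Interval ℓ
  Unit I = 0# ≤ lower I × upper I ≤ 1#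

  Encloses-wider : ∀ {x ε δ I} → ε ≤ δ → Encloses x ε I → Encloses x δ I
  Encloses-wider ε≤δ (encloses l u w) = encloses l u (≤-trans w (+-monoʳ-≤ _ ε≤δ))

  minimum : ∀ {ε δ} → 0# < ε → 0# < δ → ∃[ η ] 0# < η × η ≤ ε × η ≤ δ
  minimum {ε} {δ} 0<ε 0<δ with ≤-total ε δ
  ... | inj₁ ε≤δ = ε , 0<ε , ≤-refl , ε≤δ
  ... | inj₂ δ≤ε = δ , 0<δ , δ≤ε , ≤-refl

  -- Let s be the supremum of the t in F for which Q holds of [0,t]. As s itself may lie outside F,
  -- it never serves as an endpoint: a short interval [t, t + d] with t reachable and d in F passes
  -- over it.
  heineBorel₁ : (Q : Pred Interval ℓ) →
    (∀ {a m b} → Q (a , m) → Q (m , b) → Q (a , b)) →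
    (∀ x → 0# ≤ x → x ≤ 1# → ∃[ ε ] 0# < ε × (∀ I → Unit I → Encloses x ε I → Q I)) →
    Q (0F , 1F)
  heineBorel₁ Q glue local = conclude (local s 0≤s s≤1)
    where
    Reachable : Pred Carrier ℓ
    Reachable t = Σ (F t) λ Ft → 0# ≤ t × t ≤ 1# × Q (0F , (t , Ft))

    0≤1 : 0# ≤ 1#
    0≤1 = inj₁ 0<1

    Reachable-0 : Reachable 0#
    Reachable-0 with local 0# ≤-refl 0≤1
    ... | ε , 0<ε , near = 0-closed , ≤-refl , 0≤1 ,
      -- The degenerate interval [0,0] is a small interval around 0, which starts the construction.
      near (0F , 0F) (≤-refl , 0≤1) (encloses ≤-refl ≤-refl (x≤x+y (inj₁ 0<ε)))

    supremum : ∃[ s ] UpperBound Reachable s × (∀ b → UpperBound Reachable b → s ≤ b)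
    supremum = complete Reachable (0# , Reachable-0) (1# , λ _ (_ , _ , t≤1 , _) → t≤1)

    s : Carrier
    s = proj₁ supremum

    s-upper : UpperBound Reachable s
    s-upper = proj₁ (proj₂ supremum)

    0≤s : 0# ≤ s
    0≤s = s-upper 0# Reachable-0

    s≤1 : s ≤ 1#
    s≤1 = proj₂ (proj₂ supremum) 1# (λ _ (_ , _ , t≤1 , _) → t≤1)

    nearSupremum : ∀ {d} → 0# < d → ∃[ t ] Reachable t × s < t + d
    nearSupremum {d} 0<d with em {∃[ t ] Reachable t × s < t + d}
    ... | yes p = p
    ... | no ¬p = contradiction (proj₂ (proj₂ supremum) (s - d) s-d-upper) (<⇒≱ s-d<s)
      where
      s-d+d≈s : s - d + d ≈ s
      s-d+d≈s = trans (+-comm (s - d) d) (x+[y-x]≈y d s)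

      s-d-upper : UpperBound Reachable (s - d)
      s-d-upper t Rt = +-cancelʳ-≤ d (begin
        t + d      ≤⟨ ≮⇒≥ (λ s<t+d → ¬p (t , Rt , s<t+d)) ⟩
        s          ≈⟨ s-d+d≈s ⟨
        s - d + d  ∎)

      s-d<s : s - d < s
      s-d<s = +-cancelʳ-< d (begin-strict
        s - d + d  ≈⟨ s-d+d≈s ⟩
        s          ≈⟨ +-identityʳ s ⟨
        s + 0#     <⟨ +-monoʳ-< s 0<d ⟩
        s + d      ∎)

    conclude : ∃[ ε ] 0# < ε × (∀ I → Unit I → Encloses s ε I → Q I) → Q (0F , 1F)
    conclude (ε , 0<ε , near) with arbitrarilySmall 0<ε
    ... | d , Fd , 0<d , d≤ε with nearSupremum 0<d
    ... | t , Rt@(Ft , 0≤t , t≤1 , Q0t) , s<t+d with ≤-total (t + d) 1#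
    -- The interval [t, t + d] contains s and has width at most ε, so t + d would be reachable
    -- although it exceeds s.
    ... | inj₁ t+d≤1 = contradiction (s-upper (t + d) Reachable-t+d) (<⇒≱ s<t+d)
      where
      F[t+d] : F (t + d)
      F[t+d] = +-closed Ft Fd

      Reachable-t+d : Reachable (t + d)
      Reachable-t+d = F[t+d] , +-nonneg 0≤t (inj₁ 0<d) , t+d≤1 , glue Q0t
        (near ((t , Ft) , (t + d , F[t+d])) (0≤t , t+d≤1)
          (encloses (s-upper t Rt) (inj₁ s<t+d) (+-monoʳ-≤ t d≤ε)))
    -- Cut off at 1, the last interval still contains s, because s ≤ 1, and is no longer than d.
    ... | inj₂ 1≤t+d = glue Q0t
      (near ((t , Ft) , 1F) (0≤t , ≤-refl)
        (encloses (s-upper t Rt) s≤1 (≤-trans 1≤t+d (+-monoʳ-≤ t d≤ε))))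

  Box : ℕ → Set ℓ
  Box = Vec Interval

  UnitBox : ∀ {k} → Pred (Box k) ℓ
  UnitBox B = ∀ i → Unit (Vec.lookup B i)

  Around : ∀ {k} → Vector Carrier k → Carrier → Pred (Box k) ℓ
  Around x ε B = ∀ i → Encloses (x i) ε (Vec.lookup B i)

  -- Induction on the dimension: by the tube lemma, local validity near {x} × [0,1] for the
  -- first coordinate gives validity on slabs [0,1] × B for all small boxes B around x.
  heineBorel : ∀ k (P : Pred (Box k) ℓ) →
    (∀ B i {a m b} → P (B Vec.[ i ]≔ (a , m)) → P (B Vec.[ i ]≔ (m , b)) → P (B Vec.[ i ]≔ (a , b))) →
    (∀ x → UnitCube ℝ k x → ∃[ ε ] 0# < ε × (∀ B → UnitBox B → Around x ε B → P B)) →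
    P (Vec.replicate k (0F , 1F))
  heineBorel zero P glue local with local (λ ()) (λ ())
  ... | ε , 0<ε , near = near [] (λ ()) (λ ())
  heineBorel (suc k) P glue local =
    heineBorel k (λ B → P ((0F , 1F) ∷ B)) (λ B i → glue (_ ∷ B) (suc i)) λ x x∈cube →
      heineBorel₁ (Slab x) (Slab-glue x) (Slab-local x x∈cube)
    where
    Slab : Vector Carrier k → Pred Interval ℓ
    Slab x I = ∃[ ε ] 0# < ε × (∀ B → UnitBox B → Around x ε B → P (I ∷ B))

    Slab-glue : ∀ x {a m b} → Slab x (a , m) → Slab x (m , b) → Slab x (a , b)
    Slab-glue x {a} {m} {b} (ε , 0<ε , p) (δ , 0<δ , q) with minimum 0<ε 0<δ
    ... | η , 0<η , η≤ε , η≤δ = η , 0<η , λ B B-unit B-around →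
      glue ((a , b) ∷ B) zero (p B B-unit (Encloses-wider η≤ε ∘ B-around))
                              (q B B-unit (Encloses-wider η≤δ ∘ B-around))

    Slab-local : ∀ x → UnitCube ℝ k x → ∀ t → 0# ≤ t → t ≤ 1# →
                 ∃[ ε ] 0# < ε × (∀ I → Unit I → Encloses t ε I → Slab x I)
    Slab-local x x∈cube t 0≤t t≤1 with local (t Vector.∷ x) (λ { zero → 0≤t , t≤1 ; (suc i) → x∈cube i })
    ... | ε , 0<ε , near = ε , 0<ε , λ I I-unit I-around → ε , 0<ε , λ B B-unit B-around →
      near (I ∷ B) (λ { zero → I-unit ; (suc i) → B-unit i })
                   (λ { zero → I-around ; (suc i) → B-around i })

-- The real field as a model of T[F]: provability implies nonvanishing.

module FieldModel
  {ℓ : Level} (em : ExcludedMiddle ℓ) (ℝ : CompleteOrderedField ℓ)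
  (F : Pred (CompleteOrderedField.Carrier ℝ) ℓ) where
  open CompleteOrderedField ℝ hiding (zero) renaming (refl to ≈-refl)
  open OrderedFieldProperties ℝ using (÷-cong; <-respʳ-≈; <-respˡ-≈)

  ℝ-field : Structure (L-field (∣F∣ ℝ F))
  ℝ-field = record
    { Carrier  = Carrier
    ; equality = _≈_
    ; function = λ { 𝟘               []           → 0#
                   ; 𝟙               []           → 1#
                   ; plus            (x ∷ y ∷ []) → x + y
                   ; minus           (x ∷ y ∷ []) → x - y
                   ; times           (x ∷ y ∷ []) → x * y
                   ; divide          (x ∷ y ∷ []) → x ÷ y
                   ; (scale (a , _)) (x ∷ [])     → a * x }
    ; relation = order ℝ F
    }

  open Syntax (L-field (∣F∣ ℝ F))
  open Semantics ℝ-field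

  function-cong : ∀ {m} (f : FieldFunction (∣F∣ ℝ F) m) {xs ys : Vec Carrier m} →
                  Pointwise _≈_ xs ys →
                  Structure.function ℝ-field f xs ≈ Structure.function ℝ-field f ys
  function-cong 𝟘         []             = ≈-refl
  function-cong 𝟙         []             = ≈-refl
  function-cong plus      (p ∷ q ∷ [])   = +-cong p q
  function-cong minus     (p ∷ q ∷ [])   = +-cong p (-‿cong q)
  function-cong times     (p ∷ q ∷ [])   = *-cong p q
  function-cong divide    (p ∷ q ∷ [])   = ÷-cong p q
  function-cong (scale a) (p ∷ [])       = *-congˡ p

  relation-resp : ∀ {m} (R : OrderRelation m) {xs ys : Vec Carrier m} →
                  Pointwise _≈_ xs ys → order ℝ F R xs → order ℝ F R ys
  relation-resp less (p ∷ q ∷ []) x<y = <-respʳ-≈ q (<-respˡ-≈ p x<y)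

  add-reduct : ∀ {m} (f : AddFunction (∣F∣ ℝ F) m) xs → Structure.function (ℝ-add ℝ F) f xs ≡
               Structure.function ℝ-field (Inclusion.onFunction (add⊆field (∣F∣ ℝ F)) f) xs
  add-reduct 𝟘         []           = refl
  add-reduct 𝟙         []           = refl
  add-reduct plus      (_ ∷ _ ∷ []) = refl
  add-reduct minus     (_ ∷ _ ∷ []) = refl
  add-reduct (scale _) (_ ∷ [])     = refl

  mult-reduct : ∀ {m} (f : MultFunction (∣F∣ ℝ F) m) xs → Structure.function (ℝ-mult ℝ F) f xs ≡
                Structure.function ℝ-field (Inclusion.onFunction (mult⊆field (∣F∣ ℝ F)) f) xs
  mult-reduct 𝟘         []           = refl
  mult-reduct 𝟙         []           = refl
  mult-reduct times     (_ ∷ _ ∷ []) = refl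
  mult-reduct divide    (_ ∷ _ ∷ []) = refl
  mult-reduct (scale _) (_ ∷ [])     = refl

  T-union-holds : ∀ {φ} → T-union ℝ F φ → Holds [] φ
  T-union-holds (inj₁ (ψ , ψ-true , refl)) = to (Reduct.Holds-translate
    (add⊆field (∣F∣ ℝ F)) (ℝ-add ℝ F) (Structure.function ℝ-field) (order ℝ F)
    add-reduct (λ _ _ → refl) [] ψ) ψ-true
  T-union-holds (inj₂ (ψ , ψ-true , refl)) = to (Reduct.Holds-translate
    (mult⊆field (∣F∣ ℝ F)) (ℝ-mult ℝ F) (Structure.function ℝ-field) (order ℝ F)
    mult-reduct (λ _ _ → refl) [] ψ) ψ-true

  open Soundness em ℝ-field isEquivalence function-cong relation-resp using (sound)

  module _ {n : ℕ} (ρ : Vec Carrier n) where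
    private
      module Tm = RawSemiringDefinitions (termRawSemiring ℝ F n)
      module Re = RawSemiringDefinitions rawSemiring

    valueTerm-^ : ∀ t m → valueTerm ρ (t Tm.^ m) ≡ valueTerm ρ t Re.^ m
    valueTerm-^ t zero    = refl
    valueTerm-^ t (suc m) = cong (valueTerm ρ t *_) (valueTerm-^ t m)

    valueTerm-product : ∀ {k} (ts : Vector (Term n) k) (xs : Vector Carrier k) →
                        (∀ i → valueTerm ρ (ts i) ≡ xs i) →
                        valueTerm ρ (Tm.product ts) ≡ Re.product xs
    valueTerm-product {zero}  ts xs eq = refl
    valueTerm-product {suc k} ts xs eq =
      cong₂ _*_ (eq zero) (valueTerm-product (ts ∘ suc) (xs ∘ suc) (eq ∘ suc))

    valueTerm-polynomial : ∀ {k} (f : Polynomial (∣F∣ ℝ F) k)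
                           (ts : Vector (Term n) k) (xs : Vector Carrier k) →
                           (∀ i → valueTerm ρ (ts i) ≡ xs i) →
                           valueTerm ρ (polynomialTerm ℝ F f ts) ≡ valueAt ℝ F f xs
    valueTerm-polynomial []            ts xs eq = refl
    valueTerm-polynomial ((a , e) ∷ f) ts xs eq = cong₂ _+_
      (cong (proj₁ a *_) (valueTerm-product _ _ λ i →
        ≡.trans (valueTerm-^ (ts i) (e i)) (cong (Re._^ e i) (eq i))))
      (valueTerm-polynomial f ts xs eq)

  provable⇒nonvanishing : ∀ {k} (f : Polynomial (∣F∣ ℝ F) k) →
    T-union ℝ F ⊢ nonvanishing ℝ F f →
    ∀ x → UnitCube ℝ k x → ¬ (valueAt ℝ F f x ≈ 0#)
  provable⇒nonvanishing {k} f proof x x∈cube fx≈0 =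
    impossible (∀*-holds _ (sound T-union-holds proof [] []) ρ (⋀-holds _ inCube) value≈0)
    where
    open SemanticsProperties ℝ-field

    ρ : Vec Carrier k
    -- Index zero is the innermost variable, which stands for the last coordinate, so the point
    -- enters the environment in reverse.
    ρ = Vec.tabulate (x ∘ opposite)

    lookup-ρ : ∀ i → Vec.lookup ρ (opposite i) ≡ x i
    lookup-ρ i = ≡.trans (lookup∘tabulate (x ∘ opposite) (opposite i))
                         (cong x (opposite-involutive i))

    inCube : ∀ i → Holds ρ (_≤′_ ℝ F (0′ ℝ F) (variables ℝ F k i) ∧
                            _≤′_ ℝ F (variables ℝ F k i) (1′ ℝ F))
    inCube i = ≡.subst (λ y → 0# ≤ y × y ≤ 1#) (≡.sym (lookup-ρ i)) (x∈cube i)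

    value≈0 : valueTerm ρ (polynomialTerm ℝ F f (variables ℝ F k)) ≈ 0#
    value≈0 = ≡.subst (_≈ 0#) (≡.sym (valueTerm-polynomial ρ f _ x lookup-ρ)) fx≈0

    impossible : Holds ρ ⊥′ → _
    impossible ()

-- Interval bounds as formulas, uniformly in the language.

module IntervalFormulas
  {ℓ : Level} {A : Set ℓ} {L : Language ℓ} (one : Language.Function L 0)
  (scaling : A → Language.Function L 1) (lessThan : Language.Relation L 2) where
  open Syntax L

  private variable
    n : ℕ

  -- The languages name an element a of F only through the function f_a. The term f_a(1) exists in
  -- both of them, so a bound derived by one theory is a usable premise for the other.
  constant : A → Term n
  constant a = fun (scaling a) (fun one [] ∷ [])

  infix 8 _≼_
  _≼_ : Term n → Term n → Formula n
  s ≼ t = rel lessThan (s ∷ t ∷ []) ∨ s ≐ t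

  within : A × A → Term n → Formula n
  within (a , b) t = constant a ≼ t ∧ t ≼ constant b

-- Interval arithmetic in ℝ.

module IntervalArithmetic
  {ℓ : Level} (em : ExcludedMiddle ℓ) (ℝ : CompleteOrderedField ℓ)
  {F : Pred (CompleteOrderedField.Carrier ℝ) ℓ} (F-isSubfield : IsSubfield ℝ F) where
  open CompleteOrderedField ℝ hiding (zero) renaming (refl to ≈-refl)
  open OrderedFieldProperties ℝ
  open SubfieldProperties em ℝ F-isSubfield
  open IsSubfield F-isSubfield
  open StrictReasoning strictPartialOrder
  open RingSolver commutativeSemiring using (solve; _:+_; _:*_; _:=_)

  infix 4 _∈_
  _∈_ : Carrier → Interval → Set ℓ
  x ∈ I = lower I ≤ x × x ≤ upper I

  infixl 6 _⊕_
  infixl 7 _⊗_ _⊙_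

  _⊕_ _⊗_ : Interval → Interval → Interval
  ((a , Fa) , (b , Fb)) ⊕ ((c , Fc) , (d , Fd)) =
    (a + c , +-closed Fa Fc) , (b + d , +-closed Fb Fd)
  -- The bounds are those of the product only for intervals in [0,∞).
  ((a , Fa) , (b , Fb)) ⊗ ((c , Fc) , (d , Fd)) =
    (a * c , *-closed Fa Fc) , (b * d , *-closed Fb Fd)

  _⊙_ : ∣F∣ ℝ F → Interval → Interval
  (s , Fs) ⊙ ((a , Fa) , (b , Fb)) with ≤-total 0# s
  ... | inj₁ _ = (s * a , *-closed Fs Fa) , (s * b , *-closed Fs Fb)
  ... | inj₂ _ = (s * b , *-closed Fs Fb) , (s * a , *-closed Fs Fa)

  ∈-⊕ : ∀ {x y} I J → x ∈ I → y ∈ J → x + y ∈ I ⊕ J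
  ∈-⊕ I J (a≤x , x≤b) (c≤y , y≤d) = +-mono-≤ a≤x c≤y , +-mono-≤ x≤b y≤d

  ∈-⊗ : ∀ {x y} I J → 0# ≤ lower I → 0# ≤ lower J → x ∈ I → y ∈ J → x * y ∈ I ⊗ J
  ∈-⊗ I J 0≤a 0≤c (a≤x , x≤b) (c≤y , y≤d) =
    *-mono-≤ (≤-trans 0≤a a≤x) 0≤c a≤x c≤y ,
    *-mono-≤ (≤-trans 0≤a (≤-trans a≤x x≤b)) (≤-trans 0≤c c≤y) x≤b y≤d

  ∈-⊙ : ∀ {x} s I → x ∈ I → proj₁ s * x ∈ s ⊙ I
  ∈-⊙ (s , _) I (a≤x , x≤b) with ≤-total 0# s
  ... | inj₁ 0≤s = *-monoʳ-≤ 0≤s a≤x , *-monoʳ-≤ 0≤s x≤b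
  ... | inj₂ s≤0 = *-antimonoʳ-≤ s≤0 x≤b , *-antimonoʳ-≤ s≤0 a≤x

  Encloses⇒∈ : ∀ {x ε I} → Encloses x ε I → x ∈ I
  Encloses⇒∈ (encloses l u _) = l , u

  Encloses-⊕ : ∀ {x y ε δ} I J → Encloses x ε I → Encloses y δ J → Encloses (x + y) (ε + δ) (I ⊕ J)
  Encloses-⊕ {x} {y} {ε} {δ} I J p@(encloses _ _ w) q@(encloses _ _ v)
    with ∈-⊕ I J (Encloses⇒∈ p) (Encloses⇒∈ q)
  ... | l , u = encloses l u (begin
    upper I + upper J              ≤⟨ +-mono-≤ w v ⟩
    lower I + ε + (lower J + δ)    ≈⟨ solve 4 (λ a ε c δ → a :+ ε :+ (c :+ δ) := a :+ c :+ (ε :+ δ))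
                                        ≈-refl (lower I) ε (lower J) δ ⟩
    lower I + lower J + (ε + δ)    ∎)

  Unit-⊗ : ∀ {x y ε δ} I J → Unit I → Unit J → Encloses x ε I → Encloses y δ J → Unit (I ⊗ J)
  Unit-⊗ I J (0≤a , b≤1) (0≤c , d≤1) _ (encloses c≤y y≤d _) =
    *-nonneg 0≤a 0≤c , *-≤-1 (≤-trans 0≤c (≤-trans c≤y y≤d)) b≤1 d≤1

  -- For I = [a,b] and J = [c,d], the difference b d - a c equals b (d - c) + (b - a) c. Since b and
  -- c are at most 1, the widths simply add.
  Encloses-⊗ : ∀ {x y ε δ} I J → 0# ≤ ε → 0# ≤ δ → Unit I → Unit J →
               Encloses x ε I → Encloses y δ J → Encloses (x * y) (ε + δ) (I ⊗ J)
  Encloses-⊗ {x} {y} {ε} {δ} I J 0≤ε 0≤δ (0≤a , b≤1) (0≤c , d≤1)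
    p@(encloses a≤x x≤b b≤a+ε) q@(encloses c≤y y≤d d≤c+δ)
    with ∈-⊗ I J 0≤a 0≤c (Encloses⇒∈ p) (Encloses⇒∈ q)
  ... | l , u = encloses l u (begin
    b * d                    ≤⟨ *-monoʳ-≤ (≤-trans 0≤a (≤-trans a≤x x≤b)) d≤c+δ ⟩
    b * (c + δ)              ≈⟨ distribˡ b c δ ⟩
    b * c + b * δ            ≤⟨ +-mono-≤ (*-monoˡ-≤ 0≤c b≤a+ε) (*-monoˡ-≤ 0≤δ b≤1) ⟩
    (a + ε) * c + 1# * δ     ≈⟨ +-cong (distribʳ c a ε) (*-identityˡ δ) ⟩
    a * c + ε * c + δ        ≈⟨ +-assoc _ _ _ ⟩
    a * c + (ε * c + δ)      ≤⟨ +-monoʳ-≤ _ (+-monoˡ-≤ δ (*-monoʳ-≤ 0≤ε (≤-trans c≤y (≤-trans y≤d d≤1)))) ⟩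
    a * c + (ε * 1# + δ)     ≈⟨ +-congˡ (+-congʳ (*-identityʳ ε)) ⟩
    a * c + (ε + δ)          ∎)
    where
    a = lower I
    b = upper I
    c = lower J
    d = upper J

  -- The factor is ∣s∣.
  Encloses-⊙ : ∀ s → ∃[ r ] 0# ≤ r ×
               (∀ {x ε} I → Encloses x ε I → Encloses (proj₁ s * x) (r * ε) (s ⊙ I))
  Encloses-⊙ s′@(s , _) = factor , factor-nonneg , λ {x} {ε} I p →
    let (l , u) = ∈-⊙ s′ I (Encloses⇒∈ p) in encloses l u (width I (Encloses.width p))
    where
    factor : Carrier
    factor with ≤-total 0# s
    ... | inj₁ _ = s
    ... | inj₂ _ = - s

    factor-nonneg : 0# ≤ factor
    factor-nonneg with ≤-total 0# s
    ... | inj₁ 0≤s = 0≤s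
    ... | inj₂ s≤0 = x≤0⇒0≤-x s≤0

    width : ∀ {ε} I → upper I ≤ lower I + ε → upper (s′ ⊙ I) ≤ lower (s′ ⊙ I) + factor * ε
    width {ε} I b≤a+ε with ≤-total 0# s
    ... | inj₁ 0≤s = begin
      s * upper I            ≤⟨ *-monoʳ-≤ 0≤s b≤a+ε ⟩
      s * (lower I + ε)      ≈⟨ distribˡ s _ ε ⟩
      s * lower I + s * ε    ∎
    ... | inj₂ s≤0 = begin
      s * a                          ≈⟨ +-inverse-absorb s ε (s * a) ⟨
      s * a + (- s + s) * ε          ≈⟨ solve 4 (λ s -s a ε → s :* a :+ (-s :+ s) :* ε
                                          := s :* (a :+ ε) :+ -s :* ε) ≈-refl s (- s) a ε ⟩
      s * (a + ε) + - s * ε          ≤⟨ +-monoˡ-≤ _ (*-antimonoʳ-≤ s≤0 b≤a+ε) ⟩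
      s * upper I + - s * ε          ∎
      where a = lower I

  -- Interval arithmetic derived in T[F].

  open Syntax (L-field (∣F∣ ℝ F))
  open SyntaxProperties (L-field (∣F∣ ℝ F))
  private
    module Add  = Syntax (L-add (∣F∣ ℝ F))
    module Mult = Syntax (L-mult (∣F∣ ℝ F))
    module A = IntervalFormulas {L = L-add (∣F∣ ℝ F)} 𝟙 scale less
    module M = IntervalFormulas {L = L-mult (∣F∣ ℝ F)} 𝟙 scale less
  open IntervalFormulas {L = L-field (∣F∣ ℝ F)} 𝟙 scale less

  infix 3 _⊩_
  _⊩_ : ∀ {n} → List (Formula n) → Formula n → Set ℓ
  Γ ⊩ φ = T-union ℝ F ∣ Γ ⊢ φ

  module _ {n : ℕ} {Γ : List (Formula n)} where

    additive : ∀ {m} (φ : Add.Formula m) → (∀ ρ → Semantics.Holds (ℝ-add ℝ F) ρ φ) →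
               (ts : Vec (Term n) m) →
               Γ ⊩ subst (Vec.lookup ts) (Translation.translate (add⊆field (∣F∣ ℝ F)) φ)
    additive φ valid ts = TranslationProperties.⊢-valid (add⊆field (∣F∣ ℝ F)) (ℝ-add ℝ F)
      inj₁ φ valid (Vec.lookup ts)

    multiplicative : ∀ {m} (φ : Mult.Formula m) → (∀ ρ → Semantics.Holds (ℝ-mult ℝ F) ρ φ) →
                     (ts : Vec (Term n) m) →
                     Γ ⊩ subst (Vec.lookup ts) (Translation.translate (mult⊆field (∣F∣ ℝ F)) φ)
    multiplicative φ valid ts = TranslationProperties.⊢-valid (mult⊆field (∣F∣ ℝ F)) (ℝ-mult ℝ F)
      inj₂ φ valid (Vec.lookup ts)

    private
      x₀ y₀ : ∀ {L : Language ℓ} → Syntax.Term L 2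
      x₀ = Syntax.var zero
      y₀ = Syntax.var (suc zero)

      x₁ : ∀ {L : Language ℓ} → Syntax.Term L 1
      x₁ = Syntax.var zero

      -- `constant a` denotes a · 1.
      fromHolds : ∀ {x} I → lower I * 1# ≤ x × x ≤ upper I * 1# → x ∈ I
      fromHolds I (p , q) = ≤-trans (inj₂ (sym (*-identityʳ (lower I)))) p ,
                            ≤-trans q (inj₂ (*-identityʳ (upper I)))

      toHolds : ∀ {x} I → x ∈ I → lower I * 1# ≤ x × x ≤ upper I * 1#
      toHolds I (p , q) = ≤-trans (inj₂ (*-identityʳ (lower I))) p ,
                          ≤-trans q (inj₂ (sym (*-identityʳ (upper I))))

    ⊩-0 : Γ ⊩ within (0F , 0F) (0′ ℝ F)
    ⊩-0 = additive (A.within (0F , 0F) (Add.fun 𝟘 []))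
      (λ { [] → toHolds (0F , 0F) (≤-refl , ≤-refl) }) []

    ⊩-1 : Γ ⊩ within (1F , 1F) (1′ ℝ F)
    ⊩-1 = additive (A.within (1F , 1F) (Add.fun 𝟙 []))
      (λ { [] → toHolds (1F , 1F) (≤-refl , ≤-refl) }) []

    ⊩-plus : ∀ {t u} I J → Γ ⊩ within I t → Γ ⊩ within J u →
             Γ ⊩ within (I ⊕ J) (fun plus (t ∷ u ∷ []))
    ⊩-plus {t} {u} I J p q = ⇒-elim (⇒-elim (additive
      (A.within I x₀ Add.⇒ A.within J y₀ Add.⇒ A.within (I ⊕ J) (Add.fun plus (x₀ ∷ y₀ ∷ [])))
      (λ { (x ∷ y ∷ []) x∈I y∈J → toHolds (I ⊕ J) (∈-⊕ I J (fromHolds I x∈I) (fromHolds J y∈J)) })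
      (t ∷ u ∷ [])) p) q

    -- The one appeal to T_mult[F]; the other rules for bounds below and above are all additive.
    ⊩-times : ∀ {t u} I J → 0# ≤ lower I → 0# ≤ lower J → Γ ⊩ within I t → Γ ⊩ within J u →
              Γ ⊩ within (I ⊗ J) (fun times (t ∷ u ∷ []))
    ⊩-times {t} {u} I J 0≤I 0≤J p q = ⇒-elim (⇒-elim (multiplicative
      (M.within I x₀ Mult.⇒ M.within J y₀ Mult.⇒ M.within (I ⊗ J) (Mult.fun times (x₀ ∷ y₀ ∷ [])))
      (λ { (x ∷ y ∷ []) x∈I y∈J →
           toHolds (I ⊗ J) (∈-⊗ I J 0≤I 0≤J (fromHolds I x∈I) (fromHolds J y∈J)) })
      (t ∷ u ∷ [])) p) q

    ⊩-scale : ∀ {t} s I → Γ ⊩ within I t → Γ ⊩ within (s ⊙ I) (fun (scale s) (t ∷ []))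
    ⊩-scale {t} s I p = ⇒-elim (additive
      (A.within I x₁ Add.⇒ A.within (s ⊙ I) (Add.fun (scale s) (x₁ ∷ [])))
      (λ { (x ∷ []) x∈I → toHolds (s ⊙ I) (∈-⊙ s I (fromHolds I x∈I)) })
      (t ∷ [])) p

    ⊩-nonzero : ∀ {t} I → ¬ (0# ∈ I) → Γ ⊩ within I t → Γ ⊩ ¬′ (t ≐ 0′ ℝ F)
    ⊩-nonzero {t} I 0∉I p = ⇒-elim (additive
      (A.within I x₁ Add.⇒ Add.¬′ (x₁ Add.≐ Add.fun 𝟘 []))
      (λ { (x ∷ []) x∈I x≈0 → contradiction (0∈I (fromHolds I x∈I) x≈0) 0∉I })
      (t ∷ [])) p
      where
      0∈I : ∀ {x} → x ∈ I → x ≈ 0# → 0# ∈ I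
      0∈I (l , u) x≈0 = ≤-trans l (inj₂ x≈0) , ≤-trans (inj₂ (sym x≈0)) u

    -- The sentence to be proved bounds its variables by 0 and 1, interval formulas by f_0(1) and
    -- f_1(1); an additive sentence converts between the two.
    ⊩-unit : ∀ {t} → Γ ⊩ _≤′_ ℝ F (0′ ℝ F) t ∧ _≤′_ ℝ F t (1′ ℝ F) → Γ ⊩ within (0F , 1F) t
    ⊩-unit {t} p = ⇒-elim (additive
      (Add.fun 𝟘 [] A.≼ x₁ Add.∧ x₁ A.≼ Add.fun 𝟙 [] Add.⇒ A.within (0F , 1F) x₁)
      (λ { (x ∷ []) x∈I → toHolds (0F , 1F) x∈I })
      (t ∷ [])) p

    ⊩-total : ∀ t m → Γ ⊩ t ≼ constant m ∨ constant m ≼ t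
    ⊩-total t m = additive (x₁ A.≼ A.constant m Add.∨ A.constant m A.≼ x₁)
      (λ { (x ∷ []) → ≤-total x (proj₁ m * 1#) }) (t ∷ [])

  -- Enclosures of polynomial terms with width linear in the size of the box.

  module _ {k : ℕ} where
    private
      v : Vector (Term k) k
      v = variables ℝ F k

    -- One interval serves two purposes: it is known in ℝ to be a short interval around the value x,
    -- and known in T[F] to bound the term t.
    Enclosed UnitEnclosed : List (Formula k) → Term k → Carrier → Carrier → Set ℓ
    Enclosed     Γ t x ε = ∃[ I ] Encloses x ε I × Γ ⊩ within I t
    UnitEnclosed Γ t x ε = ∃[ I ] Unit I × Encloses x ε I × Γ ⊩ within I t

    -- M precedes Γ, x and ε because the size of the box is later chosen in terms of M. The unit
    -- version is the invariant for power products, where the rule for widths needs factors in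
    -- [0,1]; coefficients and sums leave [0,1], so beyond that point only the weaker version
    -- survives.
    Lipschitz UnitLipschitz : Term k → (Vector Carrier k → Carrier) → Set ℓ
    Lipschitz t f = ∃[ M ] 0# ≤ M × (∀ {Γ x ε} → 0# ≤ ε →
      (∀ i → UnitEnclosed Γ (v i) (x i) ε) → Enclosed Γ t (f x) (M * ε))
    UnitLipschitz t f = ∃[ M ] 0# ≤ M × (∀ {Γ x ε} → 0# ≤ ε →
      (∀ i → UnitEnclosed Γ (v i) (x i) ε) → UnitEnclosed Γ t (f x) (M * ε))

    UnitLipschitz⇒Lipschitz : ∀ {t f} → UnitLipschitz t f → Lipschitz t f
    UnitLipschitz⇒Lipschitz (M , 0≤M , enclose) = M , 0≤M , λ 0≤ε h →
      let (I , _ , p , q) = enclose 0≤ε h in I , p , q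

    Encloses-point : ∀ a {ε} → Encloses (proj₁ a) (0# * ε) (a , a)
    Encloses-point a {ε} = encloses ≤-refl ≤-refl (x≤x+y (inj₂ (sym (zeroˡ ε))))

    Lipschitz-0 : Lipschitz (0′ ℝ F) (λ _ → 0#)
    Lipschitz-0 = 0# , ≤-refl , λ _ _ → (0F , 0F) , Encloses-point 0F , ⊩-0

    UnitLipschitz-1 : UnitLipschitz (1′ ℝ F) (λ _ → 1#)
    UnitLipschitz-1 = 0# , ≤-refl , λ _ _ →
      (1F , 1F) , (inj₁ 0<1 , ≤-refl) , Encloses-point 1F , ⊩-1

    UnitLipschitz-variable : ∀ i → UnitLipschitz (v i) (λ x → x i)
    UnitLipschitz-variable i = 1# , inj₁ 0<1 , λ {Γ} {x} {ε} _ h →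
      let (I , unit , p , q) = h i in I , unit , Encloses-wider (inj₂ (sym (*-identityˡ ε))) p , q

    Lipschitz-plus : ∀ {t u f g} → Lipschitz t f → Lipschitz u g →
                     Lipschitz (fun plus (t ∷ u ∷ [])) (λ x → f x + g x)
    Lipschitz-plus (M , 0≤M , enclose-t) (N , 0≤N , enclose-u) =
      M + N , +-nonneg 0≤M 0≤N , λ {Γ} {x} {ε} 0≤ε h →
        let (I , p , Γ⊩t) = enclose-t 0≤ε h
            (J , q , Γ⊩u) = enclose-u 0≤ε h
        in I ⊕ J , Encloses-wider (inj₂ (sym (distribʳ ε M N))) (Encloses-⊕ I J p q) ,
           ⊩-plus I J Γ⊩t Γ⊩u

    UnitLipschitz-times : ∀ {t u f g} → UnitLipschitz t f → UnitLipschitz u g →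
                          UnitLipschitz (fun times (t ∷ u ∷ [])) (λ x → f x * g x)
    UnitLipschitz-times (M , 0≤M , enclose-t) (N , 0≤N , enclose-u) =
      M + N , +-nonneg 0≤M 0≤N , λ {Γ} {x} {ε} 0≤ε h →
        let (I , I-unit , p , Γ⊩t) = enclose-t 0≤ε h
            (J , J-unit , q , Γ⊩u) = enclose-u 0≤ε h
        in I ⊗ J , Unit-⊗ I J I-unit J-unit p q ,
           Encloses-wider (inj₂ (sym (distribʳ ε M N)))
             (Encloses-⊗ I J (*-nonneg 0≤M 0≤ε) (*-nonneg 0≤N 0≤ε) I-unit J-unit p q) ,
           ⊩-times I J (proj₁ I-unit) (proj₁ J-unit) Γ⊩t Γ⊩u

    Lipschitz-scale : ∀ {t f} s → Lipschitz t f →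
                      Lipschitz (fun (scale s) (t ∷ [])) (λ x → proj₁ s * f x)
    Lipschitz-scale s (M , 0≤M , enclose) =
      let (r , 0≤r , Encloses-s⊙) = Encloses-⊙ s in
      r * M , *-nonneg 0≤r 0≤M , λ {Γ} {x} {ε} 0≤ε h →
        let (I , p , Γ⊩t) = enclose 0≤ε h
        in s ⊙ I , Encloses-wider (inj₂ (sym (*-assoc r M ε))) (Encloses-s⊙ I p) , ⊩-scale s I Γ⊩t

    private
      module Tm = RawSemiringDefinitions (termRawSemiring ℝ F k)
      module Re = RawSemiringDefinitions rawSemiring

    UnitLipschitz-^ : ∀ {t f} → UnitLipschitz t f → ∀ m → UnitLipschitz (t Tm.^ m) (λ x → f x Re.^ m)
    UnitLipschitz-^ t-lip zero    = UnitLipschitz-1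
    UnitLipschitz-^ t-lip (suc m) = UnitLipschitz-times t-lip (UnitLipschitz-^ t-lip m)

    UnitLipschitz-product : ∀ {j} (ts : Vector (Term k) j) (fs : Vector Carrier k → Vector Carrier j) →
                            (∀ i → UnitLipschitz (ts i) (λ x → fs x i)) →
                            UnitLipschitz (Tm.product ts) (λ x → Re.product (fs x))
    UnitLipschitz-product {zero}  ts fs h = UnitLipschitz-1
    UnitLipschitz-product {suc j} ts fs h =
      UnitLipschitz-times (h zero) (UnitLipschitz-product (ts ∘ suc) (λ x → fs x ∘ suc) (h ∘ suc))

    Lipschitz-polynomial : (f : Polynomial (∣F∣ ℝ F) k) →
                           Lipschitz (polynomialTerm ℝ F f v) (valueAt ℝ F f)
    Lipschitz-polynomial []            = Lipschitz-0
    Lipschitz-polynomial ((a , e) ∷ f) = Lipschitz-plus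
      (Lipschitz-scale a (UnitLipschitz⇒Lipschitz
        (UnitLipschitz-product _ (λ x i → x i Re.^ e i) λ i →
          UnitLipschitz-^ (UnitLipschitz-variable i) (e i))))
      (Lipschitz-polynomial f)

    -- Choose ε such that M ε is less than the distance of y from 0; an interval around y of width
    -- at most M ε is then too short to reach 0.
    nonzero⇒separated : ∀ {y M} → 0# ≤ M → ¬ y ≈ 0# →
                        ∃[ ε ] 0# < ε × (∀ I → Encloses y (M * ε) I → ¬ (0# ∈ I))
    nonzero⇒separated {y} {M} 0≤M y≉0 with compare y 0#
    ... | tri≈ _ y≈0 _ = contradiction y≈0 y≉0
    ... | tri> _ _ 0<y with scale-below 0≤M 0<y
    ...   | ε , 0<ε , Mε<y = ε , 0<ε , λ { I (encloses l u w) (l≤0 , _) → <⇒≱ Mε<y (begin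
      y                 ≤⟨ u ⟩
      upper I           ≤⟨ w ⟩
      lower I + M * ε   ≤⟨ +-monoˡ-≤ _ l≤0 ⟩
      0# + M * ε        ≈⟨ +-identityˡ _ ⟩
      M * ε             ∎) }
    nonzero⇒separated {y} {M} 0≤M y≉0 | tri< y<0 _ _ with scale-below 0≤M (x<0⇒0<-x y<0)
    ...   | ε , 0<ε , Mε<-y = ε , 0<ε , λ { I (encloses l u w) (_ , 0≤u) → <⇒≱ (begin-strict
      upper I           ≤⟨ w ⟩
      lower I + M * ε   ≤⟨ +-monoˡ-≤ _ l ⟩
      y + M * ε         <⟨ +-monoʳ-< y Mε<-y ⟩
      y - y             ≈⟨ -‿inverseʳ y ⟩
      0#                ∎) 0≤u }

    -- Refuting f = 0 on boxes and on the whole cube.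

    InBox : List (Formula k) → Box k → Set ℓ
    InBox Γ B = ∀ i → Γ ⊩ within (Vec.lookup B i) (v i)

    -- Quantifying over all contexts lets hypotheses be replaced without manipulating
    -- a formula that describes the box.
    Excludes : Term k → Pred (Box k) ℓ
    Excludes t B = ∀ {Γ} → InBox Γ B → Γ ⊩ ¬′ (t ≐ 0′ ℝ F)

    InBox-update : ∀ {Γ B i I J} → InBox Γ (B Vec.[ i ]≔ I) → Γ ⊩ within J (v i) →
                   InBox Γ (B Vec.[ i ]≔ J)
    InBox-update {Γ} {B} {i} {I} {J} h p j with j ≟ᶠ i
    ... | yes refl = ≡.subst (λ K → Γ ⊩ within K (v i)) (≡.sym (lookup∘update i B J)) p
    ... | no j≢i   = ≡.subst (λ K → Γ ⊩ within K (v j))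
      (≡.trans (lookup∘update′ j≢i B I) (≡.sym (lookup∘update′ j≢i B J))) (h j)

    -- The case distinction takes place inside the derivation. Each branch keeps one of the old
    -- bounds on the i-th variable and takes the bound by m from the disjunct just assumed.
    Excludes-glue : ∀ {t} B i {a m b} → Excludes t (B Vec.[ i ]≔ (a , m)) →
                    Excludes t (B Vec.[ i ]≔ (m , b)) → Excludes t (B Vec.[ i ]≔ (a , b))
    Excludes-glue B i {a} {m} {b} left right {Γ} h = ∨-elim (⊩-total (v i) m)
      (left (InBox-update {B = B} h′ (∧-intro (∧-elim₁ hᵢ) (assume (here refl)))))
      (right (InBox-update {B = B} h′ (∧-intro (assume (here refl)) (∧-elim₂ hᵢ))))
      where
      h′ : ∀ {φ} → InBox (φ ∷ Γ) (B Vec.[ i ]≔ (a , b))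
      h′ j = ⊢-mono there (h j)

      hᵢ : ∀ {φ} → φ ∷ Γ ⊩ within (a , b) (v i)
      hᵢ {φ} = ≡.subst (λ K → φ ∷ Γ ⊩ within K (v i)) (lookup∘update i B (a , b)) (h′ i)

    nonvanishing⇒provable : (f : Polynomial (∣F∣ ℝ F) k) →
      (∀ x → UnitCube ℝ k x → ¬ (valueAt ℝ F f x ≈ 0#)) →
      T-union ℝ F ⊢ nonvanishing ℝ F f
    nonvanishing⇒provable f f≉0 = ∀*-intro (⇒-intro (cubeExcluded λ i →
      ≡.subst (λ I → _ ⊩ within I (v i)) (≡.sym (lookup-replicate i (0F , 1F)))
        (⊩-unit (⋀-elim _ (assume (here refl)) i))))
      where
      t : Term k
      t = polynomialTerm ℝ F f v

      locallyExcluded : ∀ x → UnitCube ℝ k x →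
                        ∃[ ε ] 0# < ε × (∀ B → UnitBox B → Around x ε B → Excludes t B)
      locallyExcluded x x∈cube =
        let (M , 0≤M , enclose) = Lipschitz-polynomial f
            (ε , 0<ε , separated) = nonzero⇒separated 0≤M (f≉0 x x∈cube)
        in ε , 0<ε , λ B B-unit B-around h →
          let (I , p , Γ⊩t) = enclose {x = x} (inj₁ 0<ε)
                                -- The sides of the box are themselves the enclosures of the
                                -- variables: `B-around` bounds their widths in ℝ, and h supplies
                                -- the derivations.
                                (λ i → Vec.lookup B i , B-unit i , B-around i , h i)
          in ⊩-nonzero I (separated I p) Γ⊩t

      cubeExcluded : Excludes t (Vec.replicate k (0F , 1F))
      cubeExcluded = heineBorel k (Excludes t) Excludes-glue locallyExcluded

theorem5p1 : {ℓ : Level} → ExcludedMiddle ℓ →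
    (ℝ : CompleteOrderedField ℓ) → let open CompleteOrderedField ℝ in
    (F : Pred Carrier ℓ) → IsSubfield ℝ F →
    (k : ℕ) (f : Polynomial (∣F∣ ℝ F) k) →
    (∀ x → UnitCube ℝ k x → ¬ (valueAt ℝ F f x ≈ 0#)) ⇔
    Syntax._⊢_ (L-field (∣F∣ ℝ F)) (T-union ℝ F) (nonvanishing ℝ F f)
theorem5p1 em ℝ F F-isSubfield k f =
  mk⇔ (IntervalArithmetic.nonvanishing⇒provable em ℝ F-isSubfield f)
      (FieldModel.provable⇒nonvanishing em ℝ F f)
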